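{- Let $S=\langle k,Q,\Pi,\pi,d,\delta\rangle$ be a concurrent game structure, let $q\in Q$ be a state, and let $\phi$ be an ATL formula over the propositions $\Pi$ and the players $\Sigma=\{1,\dots,k\}$. Let $G$ be the negation-safe extended dependency graph rooted in the configuration $\langle q,\phi\rangle$ constructed by the encoding rules given in the context. Then $\alpha^{G}_{\min}(\langle q,\phi\rangle)=1$ if and only if $q\vDash\phi$.
   Context: **Concurrent game structures.** A concurrent game structure (CGS) is a tuple $S=\langle k,Q,\Pi,\pi,d,\delta\rangle$ where $k\ge 1$ is the number of players (players are identified with $\Sigma=\{1,\dots,k\}$); $Q$ is a finite set of states; $\Pi$ is a finite set of atomic propositions; $\pi(q)\subseteq\Pi$ is the set of propositions true at $q\in Q$; for each player $a$ and state $q$, $d_a(q)\ge 1$ is the number of moves available to $a$ at $q$ (the moves are identified with $1,\dots,d_a(q)$); $D(q)=\{1,\dots,d_1(q)\}\times\dots\times\{1,\dots,d_k(q)\}$ is the set of move vectors at $q$; and $\delta(q,v)\in Q$ is the resulting state for each $q\in Q$, $v\in D(q)$. A state $q'$ is a successor of $q$ if $q'=\delta(q,v)$ for some $v\in D(q)$. A computation is an infinite sequence $\lambda=q_0,q_1,q_2,\dots$ of states such that $q_{i+1}$ is a successor of $q_i$ for all $i\ge 0$; we write $\lambda[i]=q_i$. **Strategies.** A strategy for player $a$ is a function $z_a:Q\to\mathbb{N}$ with $1\le z_a(q)\le d_a(q)$ for all $q\in Q$. For $A\subseteq\Sigma$, $\mathcal{Z}^A$ is the set of all families $Z_A=\{z_a\}_{a\in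 A}$ consisting of one strategy for each player in $A$. The set $out(q,Z_A)$ consists of all computations $\lambda=q_0,q_1,\dots$ with $q_0=q$ such that for every $i\ge 0$ there is a move vector $v=\langle j_1,\dots,j_k\rangle\in D(q_i)$ with $j_a=z_a(q_i)$ for all $a\in A$ and $\delta(q_i,v)=q_{i+1}$. **ATL.** Formulae are given by $$\phi ::= \mathbf{true}\mid p\mid\neg\phi\mid\phi_1\lor\phi_2\mid\langle\!\langle A\rangle\!\rangle\bigcirc\phi\mid\langle\!\langle A\rangle\!\rangle(\phi_1\,\mathcal{U}\,\phi_2)\mid[\![A]\!](\phi_1\,\mathcal{U}\,\phi_2)$$ with $p\in\Pi$ and $A\subseteq\Sigma$. Satisfaction is defined inductively: - $q\vDash\mathbf{true}$ always; $q\vDash p$ iff $p\in\pi(q)$; $q\vDash\neg\phi$ iff $q\not\vDash\phi$; $q\vDash\phi_1\lor\phi_2$ iff $q\vDash\phi_1$ or $q\vDash\phi_2$. - $q\vDash\langle\!\langle A\rangle\!\rangle\bigcirc\phi$ iff there is $Z_A\in\mathcal{Z}^A$ such that $\lambda[1]\vDash\phi$ for all $\lambda\in out(q,Z_A)$. - $q\vDash\langle\!\langle A\rangle\!\rangle(\phi_1\mathcal{U}\phi_2)$ iff there is $Z_A\in\mathcal{Z}^A$ such that for all $\lambda\in out(q,Z_A)$ there is $i\ge 0$ with $\lambda[i]\vDash\phi_2$ and $\lambda[j]\vDash\phi_1$ for all $0\le j<i$. - $q\vDash[\![A]\!](\phi_1\mathcal{U}\phi_2)$ iff for all $Z_A\in\mathcal{Z}^A$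 there is $\lambda\in out(q,Z_A)$ and $i\ge 0$ with $\lambda[i]\vDash\phi_2$ and $\lambda[j]\vDash\phi_1$ for all $0\le j<i$. **Extended dependency graphs.** An extended dependency graph (EDG) is $G=\langle C,E,N\rangle$ with $C$ a finite set of configurations, $E\subseteq C\times\mathcal{P}(C)$ a finite set of hyper-edges, and $N\subseteq C\times C$ a finite set of negation edges. Write $c\rightarrow c'$ if there is $\langle c,T\rangle\in E$ with $c'\in T$; $c\dashrightarrow c'$ if $\langle c,c'\rangle\in N$; and $c\rightsquigarrow c'$ if $c\rightarrow c'$ or $c\dashrightarrow c'$. $G$ is negation safe if there are no $c,c'\in C$ with $c\dashrightarrow c'$ and $c'\rightsquigarrow^* c$ (where $^*$ denotes reflexive transitive closure). For a negation-safe EDG define inductively $dist(c)=\max\{dist(c'')+1\mid c',c''\in C,\ c\rightarrow^* c'\dashrightarrow c''\}$, with $\max\emptyset=0$, and $dist(G)=\max_{c\in C}dist(c)$. For $i\ge 0$ the component $K_i$ is the subgraph given by $C_i=\{c\in C\mid dist(c)\le i\}$, $E_i=\{\langle c,T\rangle\in E\mid dist(c)\le i\}$, $N_i=\{\langle c,c'\rangle\in N\mid dist(c)\le i\}$ (so $N_0=\emptyset$). **Minimum fixed-point assignment.** An assignment is a function from configurations to $\{0,1\}$ ($0$ = false, $1$ = true), ordered pointwise. For $0\le i\le dist(G)$, $\alpha^{K_i}_{\min}$ is, by induction on $i$, the least fixed point of the monotone function $F_i$ on assignments of $C_i$ given by $$F_i(\alpha)(c)=\alpha(c)\ \lor\ \Big[\bigvee_{\langle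 c,T\rangle\in E_i}\ \bigwedge_{c'\in T}\alpha(c')\Big]\ \lor\ \Big[\bigvee_{\langle c,c'\rangle\in N_i}\neg\alpha^{K_{i-1}}_{\min}(c')\Big],$$ where an empty conjunction is true and an empty disjunction is false. Put $\alpha^G_{\min}=\alpha^{K_{dist(G)}}_{\min}$. **Partial moves.** A partial move at $q$ is a set $\mathcal{V}=V_1\times\dots\times V_k\subseteq D(q)$. For $A\subseteq\Sigma$, $pmoves(q,A)$ is the set of all partial moves $V_1\times\dots\times V_k$ obtained by choosing a move $j_a\in\{1,\dots,d_a(q)\}$ for each $a\in A$ and setting $V_a=\{j_a\}$ for $a\in A$ and $V_b=\{1,\dots,d_b(q)\}$ for $b\notin A$. Let $\Delta(q,\mathcal{V})=\{\delta(q,v)\mid v\in\mathcal{V}\}$. **Encoding.** Configurations are pairs $\langle q,\phi\rangle$ (state, formula) or triples $\langle q,\mathcal{V},\phi\rangle$ (state, partial move at that state, formula). The EDG $G$ rooted in $\langle q,\phi\rangle$ has as configurations all those reachable from $\langle q,\phi\rangle$ through the following outgoing edges, and has exactly these edges: - $\langle q,\mathbf{true}\rangle$: one hyper-edge with target set $\emptyset$. - $\langle q,p\rangle$: one hyper-edge with target set $\emptyset$ if $p\in\pi(q)$; no outgoing edges if $p\notin\pi(q)$. - $\langle q,\neg\phi\rangle$: one negation edge to $\langle q,\phi\rangle$. - $\langle q,\phi_1\lor\phi_2\rangle$: two hyper-edges, with target sets $\{\langle q,\phi_1\rangle\}$ and $\{\langle q,\phi_2\rangle\}$. - $\langle q,\langle\!\langle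 A\rangle\!\rangle\bigcirc\phi\rangle$: for each $\mathcal{V}\in pmoves(q,A)$, a hyper-edge with target set $\{\langle s,\phi\rangle\mid s\in\Delta(q,\mathcal{V})\}$. - $\langle q,\psi\rangle$ with $\psi=\langle\!\langle A\rangle\!\rangle(\phi_1\mathcal{U}\phi_2)$: a hyper-edge with target set $\{\langle q,\phi_2\rangle\}$ and, for each $\mathcal{V}\in pmoves(q,A)$, a hyper-edge with target set $\{\langle q,\phi_1\rangle\}\cup\{\langle s,\psi\rangle\mid s\in\Delta(q,\mathcal{V})\}$. - $\langle q,\psi\rangle$ with $\psi=[\![A]\!](\phi_1\mathcal{U}\phi_2)$: a hyper-edge with target set $\{\langle q,\phi_2\rangle\}$ and one hyper-edge with target set $\{\langle q,\phi_1\rangle\}\cup\{\langle q,\mathcal{V},\psi\rangle\mid\mathcal{V}\in pmoves(q,A)\}$. - $\langle q,\mathcal{V},\psi\rangle$ (triples): for each $v\in\mathcal{V}$, a hyper-edge with target set $\{\langle\delta(q,v),\psi\rangle\}$. -}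

module Defs where

open import Data.Bool.Base using (Bool; true; false; not; _∨_; if_then_else_; b≤b; f≤t)
import Data.Bool.Base as Bool
open import Data.Bool.ListAction using (all; any)
open import Data.Bool.Properties using (≤-minimum)
import Data.Bool.Properties as Boolₚ
open import Data.Fin.Base using (Fin)
open import Data.Fin.Properties using (_≟_; any?)
open import Data.Fin.Induction using (spo-wellFounded)
open import Data.Fin.Subset using (Subset; inside; outside; ⁅_⁆; ⊤; _∈_; _⊃_)
open import Data.Fin.Subset.Properties using (_∈?_)
open import Data.Fin.Subset.Induction using (⊃-wellFounded)
open import Data.List.Base using (List; []; _∷_; [_]; _++_; map; filter; concat; concatMap; cartesianProductWith; allFin; lookup; length; deduplicate)
open import Data.List.Extrema.Nat using (max)
open import Data.List.Membership.Propositional using (mapWith∈) renaming (_∈_ to _∈ˡ_)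
open import Data.List.Membership.Propositional.Properties
  using ( ∈-map⁺; ∈-map⁻; ∈-filter⁺; ∈-filter⁻; ∈-concatMap⁺; ∈-concatMap⁻; ∈-concat⁻′
        ; ∈-cartesianProductWith⁺; ∈-allFin; ∈-lookup; ∈-++⁺ˡ; ∈-++⁺ʳ; ∈-++⁻
        ; ∈-deduplicate⁺; mapWith∈-cong; mapWith∈≗map)
import Data.List.Membership.DecPropositional as DecMembership
open import Data.List.Relation.Unary.Any using (Any; here; there; index)
import Data.List.Relation.Unary.Any as Any
open import Data.List.Relation.Unary.Any.Properties using (lookup-index)
open import Data.List.Relation.Unary.Unique.Propositional using (Unique)
open import Data.List.Relation.Unary.Unique.DecPropositional.Properties using (deduplicate-!)
open import Data.List.Relation.Unary.Unique.Propositional.Properties using () renaming (filter⁺ to Unique-filter⁺)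
open import Data.Maybe.Base using (Maybe; just; nothing)
open import Data.Nat.Base using (ℕ; zero; suc; _+_; _≤_; _<_)
import Data.Nat.Properties as ℕ
open import Data.Product.Base using (∃; _×_; _,_; proj₁; proj₂)
open import Data.Product.Properties using (≡-dec)
open import Data.Sum.Base using (_⊎_; inj₁; inj₂)
open import Data.Unit.Base using () renaming (⊤ to Unit)
open import Data.Vec.Base using (Vec; tabulate) renaming (lookup to lookupᵛ)
open import Data.Vec.Properties using (lookup∘tabulate; []=⇒lookup; lookup⇒[]=)
import Data.Vec.Base as Vec
import Data.Vec.Properties as Vecₚ
open import Data.Vec.Relation.Unary.All using (All; []; _∷_)
open import Data.Vec.Relation.Unary.All.Properties using (lookup⁺)
open import Function.Base using (_∘_; const; flip)
open import Induction.WellFounded using (WellFounded; Acc; acc; module Subrelation)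
open import Relation.Binary.Construct.Closure.ReflexiveTransitive using (Star; ε; _◅_; _◅◅_)
import Relation.Binary.Construct.Closure.ReflexiveTransitive as Star
open import Relation.Binary.Core using (Rel)
open import Relation.Binary.Definitions using (Decidable; DecidableEquality)
open import Relation.Binary.Structures using (IsStrictPartialOrder)
open import Relation.Binary.PropositionalEquality using (_≡_; _≗_; refl; sym; trans; cong; subst; isEquivalence)
open import Relation.Nullary using (¬_; Dec; yes; no; does; contradiction)
open import Relation.Nullary.Decidable using (_×-dec_; map′)
open import Level using (0ℓ)

private
  variable
    n κ ρ : ℕ

-- States, players, propositions and the moves of a player at a state are
-- initial segments of ℕ.  Move vectors are heterogeneous tuples rather than
-- functions out of Fin k, so that δ respects pointwise equality of move
-- vectors without function extensionality.
record CGS : Set where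
  field
    k    : ℕ
    k≥1  : 1 ≤ k
    nQ   : ℕ
    nΠ   : ℕ
  Player = Fin k
  State  = Fin nQ
  field
    π    : State → Subset nΠ
    d    : State → Vec ℕ k
    d≥1  : ∀ a q → 1 ≤ lookupᵛ (d q) a
  Move : Player → State → Set
  Move a q = Fin (lookupᵛ (d q) a)
  D : State → Set
  D q = All Fin (d q)
  field
    δ    : ∀ q → D q → State

infix  30 ∼_ ⟪_⟫○_
infixr 20 _∨̇_

data Formula (k p : ℕ) : Set where
  verum  : Formula k p
  atom   : Fin p → Formula k p
  ∼_     : Formula k p → Formula k p
  _∨̇_    : Formula k p → Formula k p → Formula k p
  ⟪_⟫○_  : Subset k → Formula k p → Formula k p
  ⟪_⟫_U_ : Subset k → Formula k p → Formula k p → Formula k p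
  ⟦_⟧_U_ : Subset k → Formula k p → Formula k p → Formula k p

module Semantics (S : CGS) where
  open CGS S

  Successor : State → State → Set
  Successor q q′ = ∃ λ v → q′ ≡ δ q v

  record Computation : Set where
    field
      _⟨_⟩ : ℕ → State
      step : ∀ i → Successor (_⟨_⟩ i) (_⟨_⟩ (suc i))
  open Computation public using (_⟨_⟩)

  Strategy : Player → Set
  Strategy a = ∀ q → Move a q

  Strategies : Subset k → Set
  Strategies A = ∀ a → a ∈ A → Strategy a

  _∈out⟨_,_⟩ : ∀ {A} → Computation → State → Strategies A → Set
  _∈out⟨_,_⟩ {A} l q Z =
    l ⟨ 0 ⟩ ≡ q ×
    (∀ i → ∃ λ (v : D (l ⟨ i ⟩)) →
       (∀ a (a∈A : a ∈ A) → lookup⁺ v a ≡ Z a a∈A (l ⟨ i ⟩)) ×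
       δ (l ⟨ i ⟩) v ≡ l ⟨ suc i ⟩)

  infix 4 _⊨_
  _⊨_ : State → Formula k nΠ → Set
  q ⊨ verum          = Unit
  q ⊨ atom x         = x ∈ π q
  q ⊨ ∼ φ            = ¬ (q ⊨ φ)
  q ⊨ φ₁ ∨̇ φ₂        = q ⊨ φ₁ ⊎ q ⊨ φ₂
  q ⊨ ⟪ A ⟫○ φ       = ∃ λ (Z : Strategies A) → ∀ l → l ∈out⟨ q , Z ⟩ → l ⟨ 1 ⟩ ⊨ φ
  q ⊨ ⟪ A ⟫ φ₁ U φ₂  = ∃ λ (Z : Strategies A) → ∀ l → l ∈out⟨ q , Z ⟩ →
                         ∃ λ i → l ⟨ i ⟩ ⊨ φ₂ × (∀ j → j < i → l ⟨ j ⟩ ⊨ φ₁)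
  q ⊨ ⟦ A ⟧ φ₁ U φ₂  = ∀ (Z : Strategies A) → ∃ λ l → l ∈out⟨ q , Z ⟩ ×
                         ∃ λ i → l ⟨ i ⟩ ⊨ φ₂ × (∀ j → j < i → l ⟨ j ⟩ ⊨ φ₁)

Assignment : ℕ → Set
Assignment n = Fin n → Bool

infix 4 _⊑_
_⊑_ : Rel (Assignment n) 0ℓ
α ⊑ β = ∀ c → α c Bool.≤ β c

Monotone : (Assignment n → Assignment n) → Set
Monotone F = ∀ {α β} → α ⊑ β → F α ⊑ F β

record LeastFixedPoint (F : Assignment n → Assignment n) : Set where
  field
    μ     : Assignment n
    fixed : F μ ≗ μ
    least : ∀ β → F β ≗ β → μ ⊑ β

iterate : (Assignment n → Assignment n) → ℕ → Assignment n
iterate F zero    = const false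
iterate F (suc m) = F (iterate F m)

≤-intro : ∀ {a b} → (a ≡ true → b ≡ true) → a Bool.≤ b
≤-intro {false} {b}     h = ≤-minimum b
≤-intro {true}  {true}  h = b≤b
≤-intro {true}  {false} h with () ← h refl

≤-elim : ∀ {a b} → a Bool.≤ b → a ≡ true → b ≡ true
≤-elim b≤b e = e
≤-elim f≤t e = refl

module _ {F : Assignment n → Assignment n} (mono : Monotone F) where

  iterate-⊑ : ∀ m → iterate F m ⊑ iterate F (suc m)
  iterate-⊑ zero    c = ≤-minimum _
  iterate-⊑ (suc m)   = mono (iterate-⊑ m)

  private
    search : ∀ m → Acc _⊃_ (tabulate (iterate F m)) →
             ∃ λ m → F (iterate F m) ≗ iterate F m
    search m (acc rs) with any? (λ c → Boolₚ._<?_ (iterate F m c) (iterate F (suc m) c))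
    ... | no  none = m , λ c → eq _ _ (iterate-⊑ m c) (λ lt → none (c , lt))
      where
      eq : ∀ a b → a Bool.≤ b → ¬ (a Bool.< b) → b ≡ a
      eq a .a b≤b _ = refl
      eq _ _  f≤t h = contradiction Bool.f<t h
    ... | yes (c , lt) = search (suc m) (rs (sub , c , in′ , out))
      where
      ∈-tab : ∀ {α : Assignment n} {x} → α x ≡ true → x ∈ tabulate α
      ∈-tab {α} {x} e = lookup⇒[]= x (tabulate α) (trans (lookup∘tabulate α x) e)
      tab-∈ : ∀ {α : Assignment n} {x} → x ∈ tabulate α → α x ≡ true
      tab-∈ {α} {x} e = trans (sym (lookup∘tabulate α x)) ([]=⇒lookup e)
      sub : ∀ {x} → x ∈ tabulate (iterate F m) → x ∈ tabulate (iterate F (suc m))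
      sub x∈ = ∈-tab (≤-elim (iterate-⊑ m _) (tab-∈ x∈))
      hi : ∀ {a b} → a Bool.< b → b ≡ true
      hi Bool.f<t = refl
      lo : ∀ {a b} → a Bool.< b → ¬ (a ≡ true)
      lo Bool.f<t ()
      in′ : c ∈ tabulate (iterate F (suc m))
      in′ = ∈-tab (hi lt)
      out : ¬ (c ∈ tabulate (iterate F m))
      out c∈ = lo lt (tab-∈ c∈)

  abstract
    stabilises : ∃ λ m → F (iterate F m) ≗ iterate F m
    stabilises = search 0 (⊃-wellFounded _)

  lfp : LeastFixedPoint F
  lfp = record
    { μ     = iterate F (proj₁ stabilises)
    ; fixed = proj₂ stabilises
    ; least = λ β fix → below β fix (proj₁ stabilises)
    }
    where
    below : ∀ β → F β ≗ β → ∀ m → iterate F m ⊑ β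
    below β fix zero    c = ≤-minimum _
    below β fix (suc m) c = subst (_ Bool.≤_) (fix c) (mono (below β fix m) c)

module _ {R : Rel (Fin n) 0ℓ} (R? : Decidable R) where

  private
    module Reach (i : Fin n) where

      hit? : ∀ (α : Assignment n) j → Dec (∃ λ h → α h ≡ true × R h j)
      hit? α j = any? (λ h → (α h Boolₚ.≟ true) ×-dec R? h j)

      F : Assignment n → Assignment n
      F α j = does (i ≟ j) ∨ does (hit? α j)

      F⁻ : ∀ α j → F α j ≡ true → i ≡ j ⊎ ∃ λ h → α h ≡ true × R h j
      F⁻ α j e with i ≟ j | hit? α j
      ... | yes i≡j | _     = inj₁ i≡j
      ... | no  _   | yes h = inj₂ h

      F⁺ : ∀ α j → i ≡ j ⊎ (∃ λ h → α h ≡ true × R h j) → F α j ≡ true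
      F⁺ α j h with i ≟ j | hit? α j
      F⁺ α j h        | yes _  | _      = refl
      F⁺ α j h        | no  _  | yes _  = refl
      F⁺ α j (inj₁ e) | no ¬e  | no _   = contradiction e ¬e
      F⁺ α j (inj₂ h) | no _   | no ¬h  = contradiction h ¬h

      mono : Monotone F
      mono {α} {β} α⊑β j = ≤-intro λ e → F⁺ β j (up (F⁻ α j e))
        where
        up : i ≡ j ⊎ (∃ λ h → α h ≡ true × R h j) → i ≡ j ⊎ ∃ λ h → β h ≡ true × R h j
        up (inj₁ e)             = inj₁ e
        up (inj₂ (h , αh , r))  = inj₂ (h , ≤-elim (α⊑β h) αh , r)

      sound : ∀ m j → iterate F m j ≡ true → Star R i j
      sound (suc m) j e with F⁻ (iterate F m) j e
      ... | inj₁ refl         = ε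
      ... | inj₂ (h , αh , r) = sound m h αh ◅◅ (r ◅ ε)

      open LeastFixedPoint (lfp mono)

      complete : ∀ {h j} → μ h ≡ true → Star R h j → μ j ≡ true
      complete e ε        = e
      complete e (r ◅ rs) =
        complete (trans (sym (fixed _)) (F⁺ μ _ (inj₂ (_ , e , r)))) rs

  star? : Decidable (Star R)
  star? i j = map′ (sound (proj₁ (stabilises mono)) j)
                   (complete (trans (sym (fixed i)) (F⁺ μ i (inj₁ refl))))
                   (μ j Boolₚ.≟ true)
    where
    open Reach i
    open LeastFixedPoint (lfp mono)

-- Configurations are the elements of Fin size; lists are read as finite sets.
record EDG : Set where
  field
    size : ℕ
  C = Fin size
  field
    E : List (C × Subset size)
    N : List (C × C)

  infix 4 _⟶_ _⇢_ _⇝_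
  _⟶_ _⇢_ _⇝_ : Rel C 0ℓ
  c ⟶ c′ = ∃ λ T → (c , T) ∈ˡ E × c′ ∈ T
  c ⇢ c′ = (c , c′) ∈ˡ N
  c ⇝ c′ = c ⟶ c′ ⊎ c ⇢ c′

  NegationSafe : Set
  NegationSafe = ∀ {c c′} → c ⇢ c′ → ¬ Star _⇝_ c′ c

  infix 4 _⟶*⇢_
  _⟶*⇢_ : Rel C 0ℓ
  c ⟶*⇢ c″ = ∃ λ c′ → Star _⟶_ c c′ × c′ ⇢ c″

  _⟶?_ : Decidable _⟶_
  c ⟶? c′ = map′ to from (Any.any? test E)
    where
    Test : C × Subset size → Set
    Test (s , T) = s ≡ c × c′ ∈ T
    test : ∀ e → Dec (Test e)
    test (s , T) = (s ≟ c) ×-dec (c′ ∈? T)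
    to : ∀ {es} → Any Test es → ∃ λ T → (c , T) ∈ˡ es × c′ ∈ T
    to (here (refl , i)) = _ , here refl , i
    to (there t) with T , m , i ← to t = T , there m , i
    from : ∀ {es} → (∃ λ T → (c , T) ∈ˡ es × c′ ∈ T) → Any Test es
    from (T , m , i) = Any.map (λ { refl → refl , i }) m

  _⟶*⇢?_ : Decidable _⟶*⇢_
  c ⟶*⇢? c″ = any? λ c′ → star? _⟶?_ c c′ ×-dec ((c′ , c″) ∈ᴺ? N)
    where open DecMembership (≡-dec _≟_ _≟_) renaming (_∈?_ to _∈ᴺ?_)

outgoing : {A : Set} → List (Fin n × A) → Fin n → List A
outgoing es c = map proj₂ (filter (λ e → proj₁ e ≟ c) es)

edgesOf : {A : Set} → (Fin n → List A) → List (Fin n × A)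
edgesOf f = concatMap (λ c → map (c ,_) (f c)) (allFin _)

∈-edgesOf⁻ : ∀ {A : Set} (f : Fin n → List A) {c x} → (c , x) ∈ˡ edgesOf f → x ∈ˡ f c
∈-edgesOf⁻ f {c} {x} m
  with c′ , m′ ← Any.satisfied (∈-concatMap⁻ (λ c → map (c ,_) (f c)) {xs = allFin _} m)
  with _ , x∈ , refl ← ∈-map⁻ (c′ ,_) m′ = x∈

elements : Subset n → List (Fin n)
elements T = filter (_∈? T) (allFin _)

any-mono : ∀ {A : Set} {f g : A → Bool} → (∀ x → f x ≡ true → g x ≡ true) →
           ∀ xs → any f xs ≡ true → any g xs ≡ true
any-mono {f = f} {g} h (x ∷ xs) e with f x in fx | g x in gx
... | _     | true  = refl
... | true  | false with () ← trans (sym (h x fx)) gx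
... | false | false = any-mono h xs e

all-mono : ∀ {A : Set} {f g : A → Bool} → (∀ x → f x ≡ true → g x ≡ true) →
           ∀ xs → all f xs ≡ true → all g xs ≡ true
all-mono h [] e = refl
all-mono {f = f} {g} h (x ∷ xs) e with f x in fx | g x in gx
... | true  | true  = all-mono h xs e
... | true  | false with () ← trans (sym (h x fx)) gx

∨-mono : ∀ {a b c d} → (a ≡ true → b ≡ true) → (c ≡ true → d ≡ true) →
         a ∨ c ≡ true → b ∨ d ≡ true
∨-mono {b = true}          f g e = refl
∨-mono {true}  {b = false} f g e with () ← f refl
∨-mono {false} {b = false} f g e = g e

module MinimumAssignment (G : EDG) (safe : EDG.NegationSafe G) where
  open EDG G

  private
    _≺_ : Rel C 0ℓ
    y ≺ x = ∃ λ c′ → ∃ λ c″ → Star _⇝_ x c′ × c′ ⇢ c″ × Star _⇝_ c″ y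

    ≺-isStrictPartialOrder : IsStrictPartialOrder _≡_ _≺_
    ≺-isStrictPartialOrder = record
      { isEquivalence = isEquivalence
      ; irrefl        = λ { refl (_ , _ , p , e , q) → safe e (q ◅◅ p) }
      ; trans         = λ { (c , c′ , p , e , q) (b , b′ , p′ , e′ , q′) →
                            b , b′ , p′ , e′ , q′ ◅◅ (p ◅◅ (inj₂ e ◅ q)) }
      ; <-resp-≈      = (λ { refl h → h }) , (λ { refl h → h })
      }

  abstract
    ⟶*⇢-wellFounded : WellFounded (flip _⟶*⇢_)
    ⟶*⇢-wellFounded = Subrelation.wellFounded
      (λ { (c′ , p , e) → c′ , _ , Star.map inj₁ p , e , ε })
      (spo-wellFounded ≺-isStrictPartialOrder)

  -- max{ dist c″ + 1 | c ⟶*⇢ c″ } by recursion on a relation that is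
  -- well-founded because G is negation safe; see dist-unfold.
  distAcc : ∀ c → Acc (flip _⟶*⇢_) c → ℕ
  distAcc c (acc rs) = max 0 (mapWith∈ (filter (c ⟶*⇢?_) (allFin size)) λ {c″} m →
    suc (distAcc c″ (rs (proj₂ (∈-filter⁻ (c ⟶*⇢?_) {xs = allFin size} m)))))

  dist : C → ℕ
  dist c = distAcc c (⟶*⇢-wellFounded c)

  private
    distAcc-irrelevant : ∀ c p q → distAcc c p ≡ distAcc c q
    distAcc-irrelevant c (acc p) (acc q) = cong (max 0)
      (mapWith∈-cong (filter (c ⟶*⇢?_) (allFin size)) _ _ λ m →
        cong suc (distAcc-irrelevant _ (p (prf m)) (q (prf m))))
      where
      prf : ∀ {c″} → c″ ∈ˡ filter (c ⟶*⇢?_) (allFin size) → c ⟶*⇢ c″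
      prf m = proj₂ (∈-filter⁻ (c ⟶*⇢?_) {xs = allFin size} m)

  dist-unfold : ∀ c → dist c ≡ max 0 (map (suc ∘ dist) (filter (c ⟶*⇢?_) (allFin size)))
  dist-unfold c with acc rs ← ⟶*⇢-wellFounded c = cong (max 0)
    (trans (mapWith∈-cong xs _ _ λ {c″} m → cong suc (distAcc-irrelevant c″
              (rs (proj₂ (∈-filter⁻ (c ⟶*⇢?_) {xs = allFin size} m))) (⟶*⇢-wellFounded c″)))
           (mapWith∈≗map (suc ∘ dist) xs))
    where xs = filter (c ⟶*⇢?_) (allFin size)

  distG : ℕ
  distG = max 0 (map dist (allFin size))

  Eₖ : ℕ → List (C × Subset size)
  Eₖ i = filter (λ e → dist (proj₁ e) ℕ.≤? i) E

  Nₖ : ℕ → List (C × C)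
  Nₖ i = filter (λ e → dist (proj₁ e) ℕ.≤? i) N

  -- The parameter α⁻ is the minimum assignment of the previous component.
  -- Assignments of the i-th component are extended by 0 to all of C.  This is
  -- harmless: F i α⁻ does nothing at a configuration of distance > i, so its
  -- least fixed point is 0 there, and at configurations of distance ≤ i only
  -- values at configurations of distance ≤ i are consulted.
  F : ℕ → Assignment size → Assignment size → Assignment size
  F i α⁻ α c =
    α c ∨ (any (λ T → all α (elements T)) (outgoing (Eₖ i) c)
         ∨ any (λ c′ → not (α⁻ c′)) (outgoing (Nₖ i) c))

  F-monotone : ∀ i α⁻ → Monotone (F i α⁻)
  F-monotone i α⁻ {α} {β} α⊑β c = ≤-intro
    (∨-mono (≤-elim (α⊑β c))
      (∨-mono (any-mono (λ T → all-mono (λ x → ≤-elim (α⊑β x)) (elements T))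
                        (outgoing (Eₖ i) c))
              (λ e → e)))

  -- Nₖ 0 is empty (the source of a negation edge has distance at least 1), so
  -- the assignment supplied at 0 is immaterial.
  αminₖ : ℕ → Assignment size
  αminₖ zero    = LeastFixedPoint.μ (lfp (F-monotone zero (const false)))
  αminₖ (suc i) = LeastFixedPoint.μ (lfp (F-monotone (suc i) (αminₖ i)))

  αmin : Assignment size
  αmin = αminₖ distG

-- V₁ × … × Vₖ is represented by its tuple of factors.
PartialMove : Vec ℕ κ → Set
PartialMove = All Subset

members : {ds : Vec ℕ κ} → PartialMove ds → List (All Fin ds)
members []       = [ [] ]
members (V ∷ Vs) = cartesianProductWith _∷_ (elements V) (members Vs)

partialMoves : (ds : Vec ℕ κ) → Subset κ → List (PartialMove ds)
partialMoves Vec.[]       Vec.[]              = [ [] ]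
partialMoves (n Vec.∷ ds) (inside  Vec.∷ A) =
  cartesianProductWith (λ j Vs → ⁅ j ⁆ ∷ Vs) (allFin n) (partialMoves ds A)
partialMoves (n Vec.∷ ds) (outside Vec.∷ A) = map (⊤ ∷_) (partialMoves ds A)

_≟ᵖ_ : {ds : Vec ℕ κ} → DecidableEquality (PartialMove ds)
[]       ≟ᵖ []       = yes refl
(V ∷ Vs) ≟ᵖ (W ∷ Ws) = map′ (λ { (refl , refl) → refl }) (λ { refl → refl , refl })
                            (Vecₚ.≡-dec Boolₚ._≟_ V W ×-dec (Vs ≟ᵖ Ws))

private
  eq : (φ ψ : Formula κ ρ) → Maybe (φ ≡ ψ)
  eq verum verum = just refl
  eq (atom x) (atom y) with x ≟ y
  ... | yes refl = just refl
  ... | no _     = nothing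
  eq (∼ φ) (∼ ψ) with eq φ ψ
  ... | just refl = just refl
  ... | nothing   = nothing
  eq (φ ∨̇ φ′) (ψ ∨̇ ψ′) with eq φ ψ | eq φ′ ψ′
  ... | just refl | just refl = just refl
  ... | _         | _         = nothing
  eq (⟪ A ⟫○ φ) (⟪ B ⟫○ ψ) with Vecₚ.≡-dec Boolₚ._≟_ A B | eq φ ψ
  ... | yes refl | just refl = just refl
  ... | _        | _         = nothing
  eq (⟪ A ⟫ φ U φ′) (⟪ B ⟫ ψ U ψ′) with Vecₚ.≡-dec Boolₚ._≟_ A B | eq φ ψ | eq φ′ ψ′
  ... | yes refl | just refl | just refl = just refl
  ... | _        | _         | _         = nothing
  eq (⟦ A ⟧ φ U φ′) (⟦ B ⟧ ψ U ψ′) with Vecₚ.≡-dec Boolₚ._≟_ A B | eq φ ψ | eq φ′ ψ′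
  ... | yes refl | just refl | just refl = just refl
  ... | _        | _         | _         = nothing
  eq _ _ = nothing

  eq-refl : (φ : Formula κ ρ) → ¬ (eq φ φ ≡ nothing)
  eq-refl verum ()
  eq-refl (atom x) e with x ≟ x
  eq-refl (atom x) () | yes refl
  ... | no x≢x = x≢x refl
  eq-refl (∼ φ) e with eq φ φ in h
  eq-refl (∼ φ) () | just refl
  ... | nothing = eq-refl φ h
  eq-refl (φ ∨̇ ψ) e with eq φ φ in h | eq ψ ψ in h′
  eq-refl (φ ∨̇ ψ) () | just refl | just refl
  ... | nothing | _       = eq-refl φ h
  ... | just _  | nothing = eq-refl ψ h′
  eq-refl (⟪ A ⟫○ φ) e with Vecₚ.≡-dec Boolₚ._≟_ A A | eq φ φ in h
  eq-refl (⟪ A ⟫○ φ) () | yes refl | just refl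
  ... | no A≢A | _       = A≢A refl
  ... | yes _  | nothing = eq-refl φ h
  eq-refl (⟪ A ⟫ φ U ψ) e with Vecₚ.≡-dec Boolₚ._≟_ A A | eq φ φ in h | eq ψ ψ in h′
  eq-refl (⟪ A ⟫ φ U ψ) () | yes refl | just refl | just refl
  ... | no A≢A | _       | _       = A≢A refl
  ... | yes _  | nothing | _       = eq-refl φ h
  ... | yes _  | just _  | nothing = eq-refl ψ h′
  eq-refl (⟦ A ⟧ φ U ψ) e with Vecₚ.≡-dec Boolₚ._≟_ A A | eq φ φ in h | eq ψ ψ in h′
  eq-refl (⟦ A ⟧ φ U ψ) () | yes refl | just refl | just refl
  ... | no A≢A | _       | _       = A≢A refl
  ... | yes _  | nothing | _       = eq-refl φ h
  ... | yes _  | just _  | nothing = eq-refl ψ h′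

_≟ᶠ_ : DecidableEquality (Formula κ ρ)
φ ≟ᶠ ψ with eq φ ψ in h
... | just φ≡ψ = yes φ≡ψ
... | nothing  = no λ { refl → eq-refl φ h }

sub : Formula κ ρ → List (Formula κ ρ)
sub verum                = [ verum ]
sub (atom x)             = [ atom x ]
sub φ@(∼ φ₁)             = φ ∷ sub φ₁
sub φ@(φ₁ ∨̇ φ₂)          = φ ∷ sub φ₁ ++ sub φ₂
sub φ@(⟪ A ⟫○ φ₁)        = φ ∷ sub φ₁
sub φ@(⟪ A ⟫ φ₁ U φ₂)    = φ ∷ sub φ₁ ++ sub φ₂
sub φ@(⟦ A ⟧ φ₁ U φ₂)    = φ ∷ sub φ₁ ++ sub φ₂

self∈sub : (φ : Formula κ ρ) → φ ∈ˡ sub φ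
self∈sub verum           = here refl
self∈sub (atom _)        = here refl
self∈sub (∼ _)           = here refl
self∈sub (_ ∨̇ _)         = here refl
self∈sub (⟪ _ ⟫○ _)      = here refl
self∈sub (⟪ _ ⟫ _ U _)   = here refl
self∈sub (⟦ _ ⟧ _ U _)   = here refl

private
  ++-case : ∀ {A : Set} {P : Set} {x : A} xs {ys} → x ∈ˡ xs ++ ys →
            (x ∈ˡ xs → P) → (x ∈ˡ ys → P) → P
  ++-case xs m f g with ∈-++⁻ xs m
  ... | inj₁ l = f l
  ... | inj₂ r = g r

sub-trans : ∀ {χ ψ : Formula κ ρ} φ → χ ∈ˡ sub ψ → ψ ∈ˡ sub φ → χ ∈ˡ sub φ
sub-trans verum         m (here refl) = m
sub-trans (atom _)      m (here refl) = m
sub-trans (∼ _)         m (here refl) = m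
sub-trans (_ ∨̇ _)       m (here refl) = m
sub-trans (⟪ _ ⟫○ _)    m (here refl) = m
sub-trans (⟪ _ ⟫ _ U _) m (here refl) = m
sub-trans (⟦ _ ⟧ _ U _) m (here refl) = m
sub-trans (∼ φ)         m (there i) = there (sub-trans φ m i)
sub-trans (⟪ _ ⟫○ φ)    m (there i) = there (sub-trans φ m i)
sub-trans (φ ∨̇ ψ)       m (there i) = there (++-case (sub φ) i
  (λ l → ∈-++⁺ˡ (sub-trans φ m l)) (λ r → ∈-++⁺ʳ (sub φ) (sub-trans ψ m r)))
sub-trans (⟪ _ ⟫ φ U ψ) m (there i) = there (++-case (sub φ) i
  (λ l → ∈-++⁺ˡ (sub-trans φ m l)) (λ r → ∈-++⁺ʳ (sub φ) (sub-trans ψ m r)))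
sub-trans (⟦ _ ⟧ φ U ψ) m (there i) = there (++-case (sub φ) i
  (λ l → ∈-++⁺ˡ (sub-trans φ m l)) (λ r → ∈-++⁺ʳ (sub φ) (sub-trans ψ m r)))

private
  height : Formula κ ρ → ℕ
  height verum           = 0
  height (atom _)        = 0
  height (∼ φ)           = suc (height φ)
  height (φ ∨̇ ψ)         = suc (height φ + height ψ)
  height (⟪ _ ⟫○ φ)      = suc (height φ)
  height (⟪ _ ⟫ φ U ψ)   = suc (height φ + height ψ)
  height (⟦ _ ⟧ φ U ψ)   = suc (height φ + height ψ)

  sub-height : ∀ (χ φ : Formula κ ρ) → χ ∈ˡ sub φ → height χ ≤ height φ
  sub-height χ verum           (here refl) = ℕ.≤-refl
  sub-height χ (atom _)        (here refl) = ℕ.≤-refl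
  sub-height χ (∼ _)           (here refl) = ℕ.≤-refl
  sub-height χ (_ ∨̇ _)         (here refl) = ℕ.≤-refl
  sub-height χ (⟪ _ ⟫○ _)      (here refl) = ℕ.≤-refl
  sub-height χ (⟪ _ ⟫ _ U _)   (here refl) = ℕ.≤-refl
  sub-height χ (⟦ _ ⟧ _ U _)   (here refl) = ℕ.≤-refl
  sub-height χ (∼ φ)           (there i)   = ℕ.m≤n⇒m≤1+n (sub-height χ φ i)
  sub-height χ (⟪ _ ⟫○ φ)      (there i)   = ℕ.m≤n⇒m≤1+n (sub-height χ φ i)
  sub-height χ (φ ∨̇ ψ) (there i) with ∈-++⁻ (sub φ) i
  ... | inj₁ l = ℕ.m≤n⇒m≤1+n (ℕ.m≤n⇒m≤n+o (height ψ) (sub-height χ φ l))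
  ... | inj₂ r = ℕ.m≤n⇒m≤1+n (ℕ.m≤n⇒m≤o+n (height φ) (sub-height χ ψ r))
  sub-height χ (⟪ _ ⟫ φ U ψ) (there i) with ∈-++⁻ (sub φ) i
  ... | inj₁ l = ℕ.m≤n⇒m≤1+n (ℕ.m≤n⇒m≤n+o (height ψ) (sub-height χ φ l))
  ... | inj₂ r = ℕ.m≤n⇒m≤1+n (ℕ.m≤n⇒m≤o+n (height φ) (sub-height χ ψ r))
  sub-height χ (⟦ _ ⟧ φ U ψ) (there i) with ∈-++⁻ (sub φ) i
  ... | inj₁ l = ℕ.m≤n⇒m≤1+n (ℕ.m≤n⇒m≤n+o (height ψ) (sub-height χ φ l))
  ... | inj₂ r = ℕ.m≤n⇒m≤1+n (ℕ.m≤n⇒m≤o+n (height φ) (sub-height χ ψ r))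

allSubsets : ∀ n → List (Subset n)
allSubsets zero    = [ Vec.[] ]
allSubsets (suc n) = cartesianProductWith Vec._∷_ (inside ∷ outside ∷ []) (allSubsets n)

∈-allSubsets : (V : Subset n) → V ∈ˡ allSubsets n
∈-allSubsets Vec.[]       = here refl
∈-allSubsets (b Vec.∷ V) = ∈-cartesianProductWith⁺ Vec._∷_ (b∈ b) (∈-allSubsets V)
  where
  b∈ : ∀ b → b ∈ˡ inside ∷ outside ∷ []
  b∈ true  = here refl
  b∈ false = there (here refl)

allPartialMoves : (ds : Vec ℕ κ) → List (PartialMove ds)
allPartialMoves Vec.[]       = [ [] ]
allPartialMoves (n Vec.∷ ds) = cartesianProductWith _∷_ (allSubsets n) (allPartialMoves ds)

∈-allPartialMoves : {ds : Vec ℕ κ} (V : PartialMove ds) → V ∈ˡ allPartialMoves ds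
∈-allPartialMoves []       = here refl
∈-allPartialMoves (V ∷ Vs) = ∈-cartesianProductWith⁺ _∷_ (∈-allSubsets V) (∈-allPartialMoves Vs)

module Encoding (S : CGS) where
  open CGS S

  pmoves : ∀ q → Subset k → List (PartialMove (d q))
  pmoves q A = partialMoves (d q) A

  Δ : ∀ q → PartialMove (d q) → List State
  Δ q V = map (δ q) (members V)

  data Config : Set where
    ⟨_⨟_⟩   : State → Formula k nΠ → Config
    ⟨_⨟_⨟_⟩ : ∀ q → PartialMove (d q) → Formula k nΠ → Config

  hyperEdges : Config → List (List Config)
  hyperEdges ⟨ q ⨟ verum ⟩             = [ [] ]
  hyperEdges ⟨ q ⨟ atom x ⟩            = if does (x ∈? π q) then [ [] ] else []
  hyperEdges ⟨ q ⨟ ∼ φ ⟩               = []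
  hyperEdges ⟨ q ⨟ φ₁ ∨̇ φ₂ ⟩           = [ ⟨ q ⨟ φ₁ ⟩ ] ∷ [ ⟨ q ⨟ φ₂ ⟩ ] ∷ []
  hyperEdges ⟨ q ⨟ ⟪ A ⟫○ φ ⟩          = map (λ V → map ⟨_⨟ φ ⟩ (Δ q V)) (pmoves q A)
  hyperEdges ⟨ q ⨟ ψ@(⟪ A ⟫ φ₁ U φ₂) ⟩ =
    [ ⟨ q ⨟ φ₂ ⟩ ] ∷ map (λ V → ⟨ q ⨟ φ₁ ⟩ ∷ map ⟨_⨟ ψ ⟩ (Δ q V)) (pmoves q A)
  hyperEdges ⟨ q ⨟ ψ@(⟦ A ⟧ φ₁ U φ₂) ⟩ =
    [ ⟨ q ⨟ φ₂ ⟩ ] ∷ (⟨ q ⨟ φ₁ ⟩ ∷ map ⟨ q ⨟_⨟ ψ ⟩ (pmoves q A)) ∷ []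
  hyperEdges ⟨ q ⨟ V ⨟ ψ ⟩             = map (λ v → [ ⟨ δ q v ⨟ ψ ⟩ ]) (members V)

  negEdges : Config → List Config
  negEdges ⟨ q ⨟ ∼ φ ⟩ = [ ⟨ q ⨟ φ ⟩ ]
  negEdges _           = []

  Reachable : Config → Config → Set
  Reachable = Star λ c c′ → c′ ∈ˡ concat (hyperEdges c) ++ negEdges c

  _≟ᶜ_ : DecidableEquality Config
  ⟨ q ⨟ φ ⟩     ≟ᶜ ⟨ q′ ⨟ φ′ ⟩      = map′ (λ { (refl , refl) → refl }) (λ { refl → refl , refl })
                                          (q ≟ q′ ×-dec φ ≟ᶠ φ′)
  ⟨ _ ⨟ _ ⟩     ≟ᶜ ⟨ _ ⨟ _ ⨟ _ ⟩    = no λ ()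
  ⟨ _ ⨟ _ ⨟ _ ⟩ ≟ᶜ ⟨ _ ⨟ _ ⟩        = no λ ()
  ⟨ q ⨟ V ⨟ φ ⟩ ≟ᶜ ⟨ q′ ⨟ V′ ⨟ φ′ ⟩ with q ≟ q′
  ... | no q≢q′  = no λ { refl → q≢q′ refl }
  ... | yes refl = map′ (λ { (refl , refl) → refl }) (λ { refl → refl , refl })
                        (V ≟ᵖ V′ ×-dec φ ≟ᶠ φ′)

  open DecMembership _≟ᶜ_ public using () renaming (_∈?_ to _∈ᶜ?_)

  formula : Config → Formula k nΠ
  formula ⟨ _ ⨟ φ ⟩     = φ
  formula ⟨ _ ⨟ _ ⨟ φ ⟩ = φ

  hyper-sub : ∀ c {T c′} → T ∈ˡ hyperEdges c → c′ ∈ˡ T → formula c′ ∈ˡ sub (formula c)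
  hyper-sub ⟨ q ⨟ verum ⟩ (here refl) ()
  hyper-sub ⟨ q ⨟ atom x ⟩ m i with does (x ∈? π q)
  hyper-sub ⟨ q ⨟ atom x ⟩ (here refl) () | true
  hyper-sub ⟨ q ⨟ φ₁ ∨̇ φ₂ ⟩ (here refl) (here refl) = there (∈-++⁺ˡ (self∈sub φ₁))
  hyper-sub ⟨ q ⨟ φ₁ ∨̇ φ₂ ⟩ (there (here refl)) (here refl) =
    there (∈-++⁺ʳ (sub φ₁) (self∈sub φ₂))
  hyper-sub ⟨ q ⨟ ⟪ A ⟫○ φ ⟩ m i
    with V , _ , refl ← ∈-map⁻ _ m
    with s , _ , refl ← ∈-map⁻ _ i = there (self∈sub φ)
  hyper-sub ⟨ q ⨟ ⟪ A ⟫ φ₁ U φ₂ ⟩ (here refl) (here refl) =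
    there (∈-++⁺ʳ (sub φ₁) (self∈sub φ₂))
  hyper-sub ⟨ q ⨟ ⟪ A ⟫ φ₁ U φ₂ ⟩ (there m) i with ∈-map⁻ _ m
  hyper-sub ⟨ q ⨟ ⟪ A ⟫ φ₁ U φ₂ ⟩ (there m) (here refl) | V , _ , refl =
    there (∈-++⁺ˡ (self∈sub φ₁))
  hyper-sub ⟨ q ⨟ ⟪ A ⟫ φ₁ U φ₂ ⟩ (there m) (there i) | V , _ , refl
    with s , _ , refl ← ∈-map⁻ _ i = here refl
  hyper-sub ⟨ q ⨟ ⟦ A ⟧ φ₁ U φ₂ ⟩ (here refl) (here refl) =
    there (∈-++⁺ʳ (sub φ₁) (self∈sub φ₂))
  hyper-sub ⟨ q ⨟ ⟦ A ⟧ φ₁ U φ₂ ⟩ (there (here refl)) (here refl) =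
    there (∈-++⁺ˡ (self∈sub φ₁))
  hyper-sub ⟨ q ⨟ ⟦ A ⟧ φ₁ U φ₂ ⟩ (there (here refl)) (there i)
    with V , _ , refl ← ∈-map⁻ _ i = here refl
  hyper-sub ⟨ q ⨟ V ⨟ ψ ⟩ m i with ∈-map⁻ _ m
  hyper-sub ⟨ q ⨟ V ⨟ ψ ⟩ m (here refl) | v , _ , refl = self∈sub ψ

  neg-formula : ∀ c {c′} → c′ ∈ˡ negEdges c → formula c ≡ ∼ formula c′
  neg-formula ⟨ q ⨟ ∼ φ ⟩ (here refl) = refl

  succ-sub : ∀ c {c′} → c′ ∈ˡ concat (hyperEdges c) ++ negEdges c →
             formula c′ ∈ˡ sub (formula c)
  succ-sub c {c′} m = ++-case (concat (hyperEdges c)) m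
    (λ l → let T , i , j = ∈-concat⁻′ (hyperEdges c) l in hyper-sub c j i)
    (λ r → subst (λ φ → formula c′ ∈ˡ sub φ) (sym (neg-formula c r))
                 (there (self∈sub (formula c′))))

  -- A finite superset of the configurations reachable from any ⟨ q ⨟ φ ⟩.
  candidates : Formula k nΠ → List Config
  candidates φ =
    cartesianProductWith ⟨_⨟_⟩ (allFin nQ) (sub φ) ++
    concatMap (λ q → cartesianProductWith ⟨ q ⨟_⨟_⟩ (allPartialMoves (d q)) (sub φ)) (allFin nQ)

  ∈-candidates : ∀ φ c → formula c ∈ˡ sub φ → c ∈ˡ candidates φ
  ∈-candidates φ ⟨ q ⨟ ψ ⟩     m = ∈-++⁺ˡ (∈-cartesianProductWith⁺ ⟨_⨟_⟩ (∈-allFin q) m)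
  ∈-candidates φ ⟨ q ⨟ V ⨟ ψ ⟩ m = ∈-++⁺ʳ (cartesianProductWith ⟨_⨟_⟩ (allFin nQ) (sub φ))
    (∈-concatMap⁺ (λ q → cartesianProductWith ⟨ q ⨟_⨟_⟩ (allPartialMoves (d q)) (sub φ))
      (Any.map (λ { refl → ∈-cartesianProductWith⁺ ⟨ q ⨟_⨟_⟩ (∈-allPartialMoves V) m })
               (∈-allFin q)))

  reachable-sub : ∀ {c c′} → Reachable c c′ → formula c′ ∈ˡ sub (formula c)
  reachable-sub ε = self∈sub _
  reachable-sub {c} (_◅_ {j = c₁} e r) = sub-trans (formula c) (reachable-sub r) (succ-sub c e)

  module Rooted (q₀ : State) (φ₀ : Formula k nΠ) where

    root : Config
    root = ⟨ q₀ ⨟ φ₀ ⟩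

    private
      U : List Config
      U = candidates φ₀

      _↦_ : Rel (Fin (length U)) 0ℓ
      i ↦ j = lookup U j ∈ˡ concat (hyperEdges (lookup U i)) ++ negEdges (lookup U i)

      _↦?_ : Decidable _↦_
      i ↦? j = lookup U j ∈ᶜ? (concat (hyperEdges (lookup U i)) ++ negEdges (lookup U i))

      down : ∀ {i j} → Star _↦_ i j → Reachable (lookup U i) (lookup U j)
      down ε       = ε
      down (e ◅ r) = e ◅ down r

      up : ∀ {c c′} (m : formula c ∈ˡ sub φ₀) (i : Fin (length U)) → c ≡ lookup U i →
           Reachable c c′ → ∃ λ j → c′ ≡ lookup U j × Star _↦_ i j
      up m i eq ε = i , eq , ε
      up {c} m i refl (_◅_ {j = c₁} e r) =
        let m₁ = sub-trans φ₀ (succ-sub c e) m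
            u  = ∈-candidates φ₀ c₁ m₁
            j , e′ , r′ = up m₁ (index u) (lookup-index u) r
        in j , e′ , subst (_∈ˡ _) (lookup-index u) e ◅ r′

    abstract
      reachable? : ∀ c → Dec (Reachable root c)
      reachable? c = map′ to from (any? λ j → (c ≟ᶜ lookup U j) ×-dec star? _↦?_ (index u) j)
        where
        u : root ∈ˡ U
        u = ∈-candidates φ₀ root (self∈sub φ₀)
        to : (∃ λ j → c ≡ lookup U j × Star _↦_ (index u) j) → Reachable root c
        to (j , refl , r) = subst (λ x → Reachable x _) (sym (lookup-index u)) (down r)
        from : Reachable root c → ∃ λ j → c ≡ lookup U j × Star _↦_ (index u) j
        from r = up (self∈sub φ₀) (index u) (lookup-index u) r

    -- The configurations reachable from the root, without repetitions; those
    -- not reachable from it do not occur in the graph.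
    configs : List Config
    configs = filter reachable? (deduplicate _≟ᶜ_ (candidates φ₀))

    configs-unique : Unique configs
    configs-unique = Unique-filter⁺ reachable? (deduplicate-! _≟ᶜ_ (candidates φ₀))

    configs-sound : ∀ {c} → c ∈ˡ configs → Reachable root c
    configs-sound m = proj₂ (∈-filter⁻ reachable? {xs = deduplicate _≟ᶜ_ (candidates φ₀)} m)

    configs-complete : ∀ {c} → Reachable root c → c ∈ˡ configs
    configs-complete {c} r = ∈-filter⁺ reachable?
      (∈-deduplicate⁺ _≟ᶜ_ (∈-candidates φ₀ c (reachable-sub r))) r

    config : Fin (length configs) → Config
    config = lookup configs

    -- All targets of edges leaving a reachable configuration are in configs, so
    -- no element of a target set is lost here.
    ⌞_⌟ : List Config → Subset (length configs)
    ⌞ T ⌟ = tabulate λ i → does (config i ∈ᶜ? T)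

    G : EDG
    G = record
      { size = length configs
      ; E    = edgesOf (λ i → map ⌞_⌟ (hyperEdges (config i)))
      ; N    = edgesOf (λ i → filter (λ j → config j ∈ᶜ? negEdges (config i)) (allFin _))
      }

    rootIndex : EDG.C G
    rootIndex = index (configs-complete ε)

    config-rootIndex : config rootIndex ≡ root
    config-rootIndex = sym (lookup-index (configs-complete ε))

    open EDG G

    ⌞⌟⁻ : ∀ T {i} → i ∈ ⌞ T ⌟ → config i ∈ˡ T
    ⌞⌟⁻ T {i} m with config i ∈ᶜ? T
                  | trans (sym (lookup∘tabulate (λ i → does (config i ∈ᶜ? T)) i)) ([]=⇒lookup m)
    ... | yes h | _ = h

    ⟶⁻ : ∀ {i j} → i ⟶ j → ∃ λ T → T ∈ˡ hyperEdges (config i) × config j ∈ˡ T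
    ⟶⁻ {i} (T , e , m) =
      image (∈-map⁻ ⌞_⌟ (∈-edgesOf⁻ (λ h → map ⌞_⌟ (hyperEdges (config h))) e)) m
      where
      image : ∀ {T j} → (∃ λ T′ → T′ ∈ˡ hyperEdges (config i) × T ≡ ⌞ T′ ⌟) → j ∈ T →
              ∃ λ T → T ∈ˡ hyperEdges (config i) × config j ∈ˡ T
      image (T′ , t , refl) m = T′ , t , ⌞⌟⁻ T′ m

    ⇢⁻ : ∀ {i j} → i ⇢ j → config j ∈ˡ negEdges (config i)
    ⇢⁻ {i} e = proj₂ (∈-filter⁻ (λ j → config j ∈ᶜ? negEdges (config i)) {xs = allFin _}
      (∈-edgesOf⁻ (λ i → filter (λ j → config j ∈ᶜ? negEdges (config i)) (allFin _)) e))

    rank : C → ℕ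
    rank i = height (formula (config i))

    ⇢-rank : ∀ {i j} → i ⇢ j → rank j < rank i
    ⇢-rank {i} {j} e = subst (λ φ → rank j < height φ)
      (sym (neg-formula (config i) (⇢⁻ e))) ℕ.≤-refl

    ⇝-rank : ∀ {i j} → i ⇝ j → rank j ≤ rank i
    ⇝-rank {i} (inj₁ e) with T , t , m ← ⟶⁻ e =
      sub-height _ (formula (config i)) (hyper-sub (config i) t m)
    ⇝-rank (inj₂ e) = ℕ.<⇒≤ (⇢-rank e)

    ⇝*-rank : ∀ {i j} → Star _⇝_ i j → rank j ≤ rank i
    ⇝*-rank ε       = ℕ.≤-refl
    ⇝*-rank (e ◅ r) = ℕ.≤-trans (⇝*-rank r) (⇝-rank e)

    G-negationSafe : NegationSafe
    G-negationSafe e r = ℕ.<⇒≱ (⇢-rank e) (⇝*-rank r)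

    open MinimumAssignment G G-negationSafe public using (αmin)

{-# OPTIONS --safe #-}
module Submission where

-- A true configuration enters the Kleene iteration at a first stage, and it does
-- so by an edge whose targets entered earlier.  This rank makes truth well
-- founded: for ⟪A⟫(φ₁ U φ₂) it yields a memoryless strategy along which the rank
-- decreases, and for ⟦A⟧(φ₁ U φ₂) a play against any given strategy, by
-- recursion on the rank.  Conversely, false configurations are closed under the
-- opponent's best replies: if ⟪A⟫(φ₁ U φ₂) is false, each strategy admits a play
-- that stays false whenever it can, if ⟦A⟧(φ₁ U φ₂) is false, the coalition A
-- has a strategy that keeps it false, and a witness for φ₁ U φ₂ on such a play
-- would propagate truth back to its start.  The induction on φ is carried out for
-- all components Kᵢ at once, so that a negation edge, which leads from Kᵢ to
-- Kᵢ₋₁, is covered without comparing the minimum assignments of different components.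

open import Defs
open import Data.Bool.Base using (Bool; true; false; if_then_else_)
open import Data.Bool.ListAction using (any; all)
open import Data.Bool.Properties using (T-≡; T-∨; T-not-≡; ¬-not)
import Data.Bool.Properties as Boolₚ
open import Data.Fin.Base using (Fin; zero; suc; fromℕ<)
open import Data.Fin.Properties using (_≟_; any?)
open import Data.Fin.Subset using (Subset; inside; outside; ⁅_⁆; ⊤; _∈_)
open import Data.Fin.Subset.Properties using (_∈?_; ∈⊤; x∈⁅x⁆; x∈⁅y⁆⇒x≡y)
open import Data.List.Base using (List; []; _∷_; _++_; map; filter; allFin; lookup; concat)
open import Data.List.Extrema.Nat using (xs≤max; max≤v⁺)
open import Data.List.Membership.Propositional using (find; lose) renaming (_∈_ to _∈ˡ_)
open import Data.List.Membership.Propositional.Properties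
  using ( ∈-map⁺; ∈-map⁻; ∈-filter⁺; ∈-filter⁻; ∈-concatMap⁺; ∈-concat⁺′; ∈-++⁺ˡ; ∈-++⁺ʳ
        ; ∈-cartesianProductWith⁺; ∈-cartesianProductWith⁻; ∈-allFin; ∈-lookup)
import Data.List.Relation.Unary.All as ListAll
open import Data.List.Relation.Unary.All.Properties using (all⁺; all⁻)
open import Data.List.Relation.Unary.AllPairs using (_∷_)
open import Data.List.Relation.Unary.Any using (Any; here; there; index)
import Data.List.Relation.Unary.Any as Any
open import Data.List.Relation.Unary.Any.Properties using (any⁺; any⁻; lookup-index)
open import Data.List.Relation.Unary.Unique.Propositional using (Unique)
open import Data.Nat.Base using (ℕ; zero; suc; _≤_; _<_; z≤n; s≤s)
import Data.Nat.Properties as ℕ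
open import Data.Product.Base using (∃; _×_; _,_; proj₁; proj₂)
open import Data.Sum.Base using (_⊎_; inj₁; inj₂)
open import Data.Vec.Base using (Vec; tabulate) renaming (lookup to lookupᵛ)
import Data.Vec.Base as Vec
open import Data.Vec.Properties using (lookup∘tabulate; lookup⇒[]=)
open import Data.Vec.Relation.Unary.All using (All; []; _∷_)
open import Data.Vec.Relation.Unary.All.Properties using (lookup⁺)
open import Function.Base using (_∘_; const)
open import Function.Bundles using (_⇔_; mk⇔; Equivalence)
open import Relation.Binary.Construct.Closure.ReflexiveTransitive using (Star; ε; _◅_; _◅◅_)
open import Relation.Binary.PropositionalEquality using (_≡_; refl; sym; trans; cong; subst; subst₂)
open import Relation.Nullary using (¬_; Dec; yes; no; does; contradiction)
open import Relation.Nullary.Decidable using (dec-true; _×-dec_)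

open Equivalence using (to; from)

private
  variable
    n κ : ℕ

-- Membership in the lists and subsets that stand for finite sets.

∈-outgoing⁺ : {A : Set} {es : List (Fin n × A)} {c : Fin n} {x : A} →
              (c , x) ∈ˡ es → x ∈ˡ outgoing es c
∈-outgoing⁺ {c = c} m = ∈-map⁺ proj₂ (∈-filter⁺ (λ e → proj₁ e ≟ c) m refl)

∈-outgoing⁻ : {A : Set} {es : List (Fin n × A)} {c : Fin n} {x : A} →
              x ∈ˡ outgoing es c → (c , x) ∈ˡ es
∈-outgoing⁻ {es = es} {c} m with _ , m′ , refl ← ∈-map⁻ proj₂ m
  with m″ , refl ← ∈-filter⁻ (λ e → proj₁ e ≟ c) {xs = es} m′ = m″

∈-edgesOf⁺ : {A : Set} (f : Fin n → List A) {c : Fin n} {x : A} →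
             x ∈ˡ f c → (c , x) ∈ˡ edgesOf f
∈-edgesOf⁺ f {c} m = ∈-concatMap⁺ (λ c → map (c ,_) (f c))
  (Any.map (λ { refl → ∈-map⁺ (c ,_) m }) (∈-allFin c))

∈-elements⁺ : {V : Subset n} {x : Fin n} → x ∈ V → x ∈ˡ elements V
∈-elements⁺ {V = V} {x} = ∈-filter⁺ (_∈? V) (∈-allFin x)

∈-elements⁻ : {V : Subset n} {x : Fin n} → x ∈ˡ elements V → x ∈ V
∈-elements⁻ {V = V} m = proj₂ (∈-filter⁻ (_∈? V) {xs = allFin _} m)

lookup-injective : {A : Set} {xs : List A} → Unique xs → ∀ i j → lookup xs i ≡ lookup xs j → i ≡ j
lookup-injective {xs = _ ∷ _} (_  ∷ _) zero    zero    _ = refl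
lookup-injective {xs = _ ∷ _} (x∉ ∷ _) zero    (suc j) e =
  contradiction e (ListAll.lookup x∉ (∈-lookup j))
lookup-injective {xs = _ ∷ _} (x∉ ∷ _) (suc i) zero    e =
  contradiction (sym e) (ListAll.lookup x∉ (∈-lookup i))
lookup-injective {xs = _ ∷ _} (_  ∷ u) (suc i) (suc j) e = cong suc (lookup-injective u i j e)

-- Stages of the Kleene iteration of a monotone map.

module Stages {F : Assignment n → Assignment n} (mono : Monotone F) where

  iterate-mono : ∀ {m m′} → m ≤ m′ → ∀ {c} → iterate F m c ≡ true → iterate F m′ c ≡ true
  iterate-mono {m} {zero}   z≤n e = e
  iterate-mono {m} {suc m′} m≤ e with ℕ.m≤n⇒m<n∨m≡n m≤
  ... | inj₂ refl       = e
  ... | inj₁ (s≤s m≤m′) = ≤-elim (iterate-⊑ mono m′ _) (iterate-mono m≤m′ e)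

  -- The first index up to `M` at which `c` is true; the default is `M` if there is none.
  stage : ℕ → Fin n → ℕ
  stage zero    c = 0
  stage (suc M) c = if iterate F M c then stage M c else suc M

  stage-≤ : ∀ {m M c} → m ≤ M → iterate F m c ≡ true → stage M c ≤ m
  stage-≤ {M = zero} z≤n e = z≤n
  stage-≤ {m} {suc M} {c} m≤ e with ℕ.m≤n⇒m<n∨m≡n m≤ | iterate F M c in eq
  ... | inj₁ (s≤s m≤M) | true  = stage-≤ m≤M e
  ... | inj₁ (s≤s m≤M) | false with () ← trans (sym (iterate-mono m≤M e)) eq
  ... | inj₂ refl      | true  = ℕ.m≤n⇒m≤1+n (stage-≤ (ℕ.≤-refl {M}) eq)
  ... | inj₂ refl      | false = ℕ.≤-refl

  -- Nothing is true at stage 0, so a first stage is a successor `suc r`, and `c` is still false at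
  -- `r`. Its truth one step later is therefore the work of `F` alone.
  stage-first : ∀ M {c} → iterate F M c ≡ true →
                ∃ λ r → stage M c ≡ suc r × r < M ×
                        F (iterate F r) c ≡ true × iterate F r c ≡ false
  stage-first (suc M) {c} e with iterate F M c in eq
  ... | false = M , refl , ℕ.≤-refl , e , eq
  ... | true  with r , s , r<M , h ← stage-first M eq = r , s , ℕ.m≤n⇒m≤1+n r<M , h

-- Distances, components and their minimum assignments.

module Layers (G : EDG) (safe : EDG.NegationSafe G) where
  open EDG G
  open MinimumAssignment G safe

  ⇢⇒dist< : ∀ {c c′ c″} → Star _⟶_ c c′ → c′ ⇢ c″ → dist c″ < dist c
  ⇢⇒dist< {c} {c″ = c″} p e rewrite dist-unfold c =
    ListAll.lookup (xs≤max 0 _) (∈-map⁺ (suc ∘ dist) (∈-filter⁺ (c ⟶*⇢?_) (∈-allFin c″) (_ , p , e)))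

  -- A negation edge that can be reached from `c′` can be reached from `c` through the given edge,
  -- so the maximum defining `dist c` dominates each term of the one for `c′`. Components are thus
  -- closed under hyper-edges.
  ⟶⇒dist≤ : ∀ {c c′} → c ⟶ c′ → dist c′ ≤ dist c
  ⟶⇒dist≤ {c} {c′} e = subst (_≤ dist c) (sym (dist-unfold c′))
    (max≤v⁺ z≤n (ListAll.tabulate λ m → below (∈-map⁻ (suc ∘ dist) m)))
    where
    below : ∀ {v} → (∃ λ x → x ∈ˡ filter (c′ ⟶*⇢?_) (allFin size) × v ≡ suc (dist x)) →
            v ≤ dist c
    below (x , m , refl) with _ , p , e′ ← proj₂ (∈-filter⁻ (c′ ⟶*⇢?_) {xs = allFin size} m) =
      ⇢⇒dist< (e ◅ p) e′

  dist≤distG : ∀ c → dist c ≤ distG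
  dist≤distG c = ListAll.lookup (xs≤max 0 _) (∈-map⁺ dist (∈-allFin c))

  -- Extends the sequence of minimum assignments below 0 by the one supplied to `αminₖ zero`, so
  -- that all components are least fixed points of the same form.
  previous : ℕ → Assignment size
  previous zero    = const false
  previous (suc i) = αminₖ i

  -- The right-hand side of the fixed-point equation at c without its
  -- inflationary disjunct α(c).
  Justified : ℕ → (C → Set) → C → Set
  Justified i P c = (∃ λ T → (c , T) ∈ˡ E × ∀ {c′} → c′ ∈ T → P c′)
                  ⊎ (∃ λ c′ → c ⇢ c′ × previous i c′ ≡ false)

  F-justified⁻ : ∀ i {α c} → F i (previous i) α c ≡ true →
                 α c ≡ true ⊎ Justified i (λ c′ → α c′ ≡ true) c
  F-justified⁻ i {α} {c} e with to T-∨ (from T-≡ e)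
  ... | inj₁ t = inj₁ (to T-≡ t)
  ... | inj₂ t with to (T-∨ {any (λ T → all α (elements T)) (outgoing (Eₖ i) c)}) t
  ... | inj₁ t with T , m , h ← find (any⁻ _ (outgoing (Eₖ i) c) t) =
    inj₂ (inj₁ (T , proj₁ (∈-filter⁻ (λ e → dist (proj₁ e) ℕ.≤? i) {xs = E}
                        (∈-outgoing⁻ {es = Eₖ i} m)) ,
                λ c′∈T → to T-≡ (ListAll.lookup (all⁺ α (elements T) h) (∈-elements⁺ c′∈T))))
  ... | inj₂ t with c′ , m , h ← find (any⁻ _ (outgoing (Nₖ i) c) t) =
    inj₂ (inj₂ (c′ , proj₁ (∈-filter⁻ (λ e → dist (proj₁ e) ℕ.≤? i) {xs = N}
                         (∈-outgoing⁻ {es = Nₖ i} m)) ,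
                to T-not-≡ h))

  -- The bound on `dist c` keeps the justifying edge in `Eₖ i` or `Nₖ i`.
  F-justified⁺ : ∀ i {α c} → dist c ≤ i → Justified i (λ c′ → α c′ ≡ true) c →
                 F i (previous i) α c ≡ true
  F-justified⁺ i {α} {c} d≤i (inj₁ (T , m , h)) = to T-≡ (from (T-∨ {α c}) (inj₂ (from T-∨ (inj₁
    (any⁺ _ (lose (∈-outgoing⁺ (∈-filter⁺ (λ e → dist (proj₁ e) ℕ.≤? i) m d≤i))
      (all⁻ α (ListAll.tabulate λ c′∈ → from T-≡ (h (∈-elements⁻ c′∈))))))))))
  F-justified⁺ i {α} {c} d≤i (inj₂ (c′ , m , h)) = to T-≡ (from (T-∨ {α c}) (inj₂
    (from (T-∨ {any (λ T → all α (elements T)) (outgoing (Eₖ i) c)}) (inj₂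
    (any⁺ _ (lose (∈-outgoing⁺ (∈-filter⁺ (λ e → dist (proj₁ e) ℕ.≤? i) m d≤i)) (from T-not-≡ h)))))))

  layer : ∀ i → LeastFixedPoint (F i (previous i))
  layer i = lfp (F-monotone i (previous i))

  αminₖ-layer : ∀ i → αminₖ i ≡ LeastFixedPoint.μ (layer i)
  αminₖ-layer zero    = refl
  αminₖ-layer (suc i) = refl

  αminₖ-closed : ∀ i {c} → dist c ≤ i → Justified i (λ c′ → αminₖ i c′ ≡ true) c →
                 αminₖ i c ≡ true
  αminₖ-closed i {c} d≤i h rewrite αminₖ-layer i =
    trans (sym (LeastFixedPoint.fixed (layer i) c)) (F-justified⁺ i d≤i h)

  -- The rank has to drop along hyper-edges only: a negation edge refers to the previous component,
  -- whose assignment is already settled.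
  Ranking : ℕ → (C → ℕ) → Set
  Ranking i rank = ∀ {c} → αminₖ i c ≡ true →
                   Justified i (λ c′ → αminₖ i c′ ≡ true × rank c′ < rank c) c

  module _ (i : ℕ) where
    open Stages (F-monotone i (previous i))

    private
      M : ℕ
      M = proj₁ (stabilises (F-monotone i (previous i)))

      α : ℕ → Assignment size
      α = iterate (F i (previous i))

      stage-justified : ∀ {c} → α M c ≡ true →
                        Justified i (λ c′ → α M c′ ≡ true × stage M c′ < stage M c) c
      stage-justified {c} e with stage-first M e
      ... | r , s , r<M , e , ¬e with F-justified⁻ i e
      -- At stage `r` the configuration `c` is false, so the inflationary disjunct cannot be the
      -- reason for its truth.
      ...   | inj₁ e′ = contradiction (trans (sym e′) ¬e) λ ()
      ...   | inj₂ (inj₂ j) = inj₂ j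
      -- The targets are true at stage `r` already, and `c` has stage `suc r`.
      ...   | inj₂ (inj₁ (T , m , h)) = inj₁ (T , m , λ c′∈T →
        iterate-mono (ℕ.<⇒≤ r<M) (h c′∈T) ,
        subst (_ <_) (sym s) (s≤s (stage-≤ (ℕ.<⇒≤ r<M) (h c′∈T))))

    abstract
      ranking : ∃ (Ranking i)
      ranking = stage M , λ {c} → subst (λ μ → μ c ≡ true →
          Justified i (λ c′ → μ c′ ≡ true × stage M c′ < stage M c) c)
        (sym (αminₖ-layer i)) stage-justified

-- Partial moves as joint choices of a coalition.

Choice : Vec ℕ κ → Subset κ → Set
Choice ds A = ∀ a → a ∈ A → Fin (lookupᵛ ds a)

module _ {A : Subset κ} {ds : Vec ℕ κ} where

  record _Follows_ (v : All Fin ds) (j : Choice ds A) : Set where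
    constructor follows
    field agrees : ∀ a (a∈A : a ∈ A) → lookup⁺ v a ≡ j a a∈A
  open _Follows_ public

  record _Represents_ (V : PartialMove ds) (j : Choice ds A) : Set where
    constructor represents
    field
      member⇒follows : ∀ {v} → v ∈ˡ members V → v Follows j
      follows⇒member : ∀ {v} → v Follows j → v ∈ˡ members V
  open _Represents_ public

module _ {b : Bool} {A : Subset κ} {m : ℕ} {ds : Vec ℕ κ} where

  tailChoice : Choice (m Vec.∷ ds) (b Vec.∷ A) → Choice ds A
  tailChoice j a a∈A = j (suc a) (Vec.there a∈A)

inside-Represents : {A : Subset κ} {m : ℕ} {ds : Vec ℕ κ} {V : PartialMove ds}
                    (j : Choice (m Vec.∷ ds) (inside Vec.∷ A)) →
                    V Represents tailChoice j → (⁅ j zero Vec.here ⁆ ∷ V) Represents j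
inside-Represents {V = V} j rep = represents fwd bwd
  where
  x = j zero Vec.here
  fwd : ∀ {v} → v ∈ˡ members (⁅ x ⁆ ∷ V) → v Follows j
  fwd m with _ , _ , x∈ , v∈ , refl ← ∈-cartesianProductWith⁻ _∷_ (elements ⁅ x ⁆) (members V) m =
    follows λ { zero    Vec.here      → x∈⁅y⁆⇒x≡y x (∈-elements⁻ x∈)
              ; (suc a) (Vec.there p) → agrees (member⇒follows rep v∈) a p }
  bwd : ∀ {v} → v Follows j → v ∈ˡ members (⁅ x ⁆ ∷ V)
  bwd {y ∷ v} f = ∈-cartesianProductWith⁺ _∷_
    (∈-elements⁺ (subst (_∈ ⁅ x ⁆) (sym (agrees f zero Vec.here)) (x∈⁅x⁆ x)))
    (follows⇒member rep (follows λ a p → agrees f (suc a) (Vec.there p)))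

outside-Represents : {A : Subset κ} {m : ℕ} {ds : Vec ℕ κ} {V : PartialMove ds}
                     (j : Choice (m Vec.∷ ds) (outside Vec.∷ A)) →
                     V Represents tailChoice j → (⊤ ∷ V) Represents j
outside-Represents {m = m} {V = V} j rep = represents fwd bwd
  where
  fwd : ∀ {v} → v ∈ˡ members (⊤ ∷ V) → v Follows j
  fwd m∈ with _ , _ , _ , v∈ , refl ← ∈-cartesianProductWith⁻ _∷_ (elements (⊤ {m})) (members V) m∈ =
    follows λ { (suc a) (Vec.there p) → agrees (member⇒follows rep v∈) a p }
  bwd : ∀ {v} → v Follows j → v ∈ˡ members (⊤ ∷ V)
  bwd {y ∷ v} f = ∈-cartesianProductWith⁺ _∷_ (∈-elements⁺ ∈⊤)
    (follows⇒member rep (follows λ a p → agrees f (suc a) (Vec.there p)))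

[]-Represents : (j : Choice Vec.[] Vec.[]) → [] Represents j
[]-Represents j = represents (λ _ → follows λ ()) λ { {[]} _ → here refl }

-- Together with `choice` this matches the partial moves of a coalition with its joint choices, so
-- that edges of the graph and values of strategies at a state can be exchanged for each other.
partialMove : (ds : Vec ℕ κ) (A : Subset κ) (j : Choice ds A) →
              ∃ λ V → V ∈ˡ partialMoves ds A × V Represents j
partialMove Vec.[]       Vec.[]             j = [] , here refl , []-Represents j
partialMove (_ Vec.∷ ds) (inside  Vec.∷ A) j
  with V , m , rep ← partialMove ds A (tailChoice j) =
  _ , ∈-cartesianProductWith⁺ _ (∈-allFin (j zero Vec.here)) m , inside-Represents j rep
partialMove (_ Vec.∷ ds) (outside Vec.∷ A) j
  with V , m , rep ← partialMove ds A (tailChoice j) =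
  _ , ∈-map⁺ (⊤ ∷_) m , outside-Represents j rep

choice : (ds : Vec ℕ κ) (A : Subset κ) {V : PartialMove ds} → V ∈ˡ partialMoves ds A →
         ∃ λ (j : Choice ds A) → V Represents j
choice Vec.[]       Vec.[]             (here refl) = (λ _ ()) , []-Represents _
choice (n Vec.∷ ds) (inside  Vec.∷ A) m
  with x , _ , _ , m′ , refl ← ∈-cartesianProductWith⁻ _ (allFin n) (partialMoves ds A) m
  with j , rep ← choice ds A m′ = j′ , inside-Represents j′ rep
  where
  j′ : Choice (n Vec.∷ ds) (inside Vec.∷ A)
  j′ zero    Vec.here      = x
  j′ (suc a) (Vec.there p) = j a p
choice (n Vec.∷ ds) (outside Vec.∷ A) m
  with _ , m′ , refl ← ∈-map⁻ (⊤ ∷_) m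
  with j , rep ← choice ds A m′ = j′ , outside-Represents j′ rep
  where
  j′ : Choice (n Vec.∷ ds) (outside Vec.∷ A)
  j′ (suc a) (Vec.there p) = j a p

-- Players outside the coalition move by the given default, so every joint choice is followed by
-- some move vector.
follower : {ds : Vec ℕ κ} {A : Subset κ} → (∀ a → Fin (lookupᵛ ds a)) → (j : Choice ds A) →
           ∃ λ (v : All Fin ds) → v Follows j
follower {ds = Vec.[]}     {Vec.[]}           _ j = [] , follows λ ()
follower {ds = _ Vec.∷ _} {inside  Vec.∷ _} f j with v , fol ← follower (f ∘ suc) (tailChoice j) =
  j zero Vec.here ∷ v , follows λ { zero Vec.here → refl ; (suc a) (Vec.there p) → agrees fol a p }
follower {ds = _ Vec.∷ _} {outside Vec.∷ _} f j with v , fol ← follower (f ∘ suc) (tailChoice j) =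
  f zero ∷ v , follows λ { (suc a) (Vec.there p) → agrees fol a p }

-- Strategies, plays and the until operator.

module Plays (S : CGS) where
  open CGS S
  open Semantics S
  open Encoding S using (pmoves)

  defaultMove : ∀ q a → Move a q
  defaultMove q a = fromℕ< (d≥1 a q)

  at : ∀ {A} → Strategies A → ∀ q → Choice (d q) A
  at Z q a a∈A = Z a a∈A q

  -- A strategy depends on the state alone, so `j` must be fixed before any good partial move is
  -- exhibited. It is read off the first one found by search, hence the conclusion about `W` rather
  -- than about the given `V`.
  select : ∀ q A {P : PartialMove (d q) → Set} → (∀ V → Dec (P V)) →
           ∃ λ (j : Choice (d q) A) →
             ∀ {V} → V ∈ˡ pmoves q A → P V → ∃ λ W → W ∈ˡ pmoves q A × P W × W Represents j
  select q A P? with Any.any? P? (pmoves q A)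
  ... | no  none = (λ a _ → defaultMove q a) , λ m p → contradiction (lose m p) none
  ... | yes some with W , m , p ← find some with j , rep ← choice (d q) A m =
    j , λ _ _ → W , m , p , rep

  -- A next formula constrains only the move at `q`; elsewhere any move will do.
  override : ∀ {A} q → Choice (d q) A → Strategies A
  override q j a a∈A s with s ≟ q
  ... | yes refl = j a a∈A
  ... | no  _    = defaultMove s a

  override-at : ∀ {A} q (j : Choice (d q) A) a (a∈A : a ∈ A) → override q j a a∈A q ≡ j a a∈A
  override-at q j a a∈A with q ≟ q
  ... | yes refl = refl
  ... | no  q≢q  = contradiction refl q≢q

  -- The step condition of `out` freed from the initial state, so that it passes to tails and to
  -- prolonged plays.
  Obeys : ∀ {A} → Strategies A → Computation → Set
  Obeys Z l = ∀ i → ∃ λ (v : D (l ⟨ i ⟩)) → v Follows at Z (l ⟨ i ⟩) × δ (l ⟨ i ⟩) v ≡ l ⟨ suc i ⟩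

  module _ {A} (Z : Strategies A) where

    arbitraryMove : ∀ q → ∃ λ (v : D q) → v Follows at Z q
    arbitraryMove q = follower (defaultMove q) (at Z q)

    module _ (next : ∀ q → ∃ λ (v : D q) → v Follows at Z q) where

      states : State → ℕ → State
      states q zero    = q
      states q (suc n) = δ (states q n) (proj₁ (next (states q n)))

      run : State → Computation
      run q = record { _⟨_⟩ = states q ; step = λ n → _ , refl }

      run-Obeys : ∀ q → Obeys Z (run q)
      run-Obeys q n = _ , proj₂ (next (states q n)) , refl

  tail : Computation → Computation
  tail l = record { _⟨_⟩ = λ i → l ⟨ suc i ⟩ ; step = λ i → Computation.step l (suc i) }

  module _ (q : State) (v : D q) (l : Computation) (l₀≡ : l ⟨ 0 ⟩ ≡ δ q v) where

    cons : Computation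
    cons = record { _⟨_⟩ = st ; step = stp }
      where
      st : ℕ → State
      st zero    = q
      st (suc n) = l ⟨ n ⟩
      stp : ∀ i → Successor (st i) (st (suc i))
      stp zero    = v , l₀≡
      stp (suc n) = Computation.step l n

    cons-Obeys : ∀ {A} (Z : Strategies A) → v Follows at Z q → Obeys Z l → Obeys Z cons
    cons-Obeys Z f o zero    = v , f , sym l₀≡
    cons-Obeys Z f o (suc n) = o n

  Until : Formula k nΠ → Formula k nΠ → Computation → Set
  Until φ₁ φ₂ l = ∃ λ i → l ⟨ i ⟩ ⊨ φ₂ × (∀ j → j < i → l ⟨ j ⟩ ⊨ φ₁)

  until-now : ∀ {φ₁ φ₂} l → l ⟨ 0 ⟩ ⊨ φ₂ → Until φ₁ φ₂ l
  until-now l h = 0 , h , λ _ ()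

  until-later : ∀ {φ₁ φ₂} l → l ⟨ 0 ⟩ ⊨ φ₁ → Until φ₁ φ₂ (tail l) → Until φ₁ φ₂ l
  until-later l h₁ (i , h₂ , h) = suc i , h₂ , λ { zero _ → h₁ ; (suc j) (s≤s j<i) → h j j<i }

  -- Induction from the witness for `φ₂` back to the start of the play, across states that satisfy
  -- `φ₁`.
  until-backward : ∀ {φ₁ φ₂} (P : State → Set) l →
                   (∀ j → l ⟨ j ⟩ ⊨ φ₂ → P (l ⟨ j ⟩)) →
                   (∀ j → l ⟨ j ⟩ ⊨ φ₁ → P (l ⟨ suc j ⟩) → P (l ⟨ j ⟩)) →
                   Until φ₁ φ₂ l → P (l ⟨ 0 ⟩)
  until-backward {φ₁} {φ₂} P l base step (i , h₂ , h) = go i base step h₂ h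
    where
    -- Generalised to arbitrary sequences of states, which the recursion shifts by one.
    go : ∀ i {s : ℕ → State} → (∀ j → s j ⊨ φ₂ → P (s j)) →
         (∀ j → s j ⊨ φ₁ → P (s (suc j)) → P (s j)) →
         s i ⊨ φ₂ → (∀ j → j < i → s j ⊨ φ₁) → P (s 0)
    go zero    b st h₂ h = b 0 h₂
    go (suc i) b st h₂ h = st 0 (h 0 (s≤s z≤n))
      (go i (b ∘ suc) (st ∘ suc) h₂ λ j j<i → h (suc j) (s≤s j<i))

-- The properties of minimum assignments on which correctness rests.

module _ (S : CGS) where
  open Encoding S

  -- InLayer i c stands for c ∈ Cᵢ and val i for the minimum assignment of Kᵢ.
  record Valuation : Set₁ where
    field
      InLayer : ℕ → Config → Set
      val     : ℕ → Config → Bool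
      level   : ℕ → Config → ℕ

    -- In the second case the condition is empty for `i = 0`, but there `neg-InLayer` rules out
    -- negation edges.
    Founded : ℕ → Config → Set
    Founded i c = (∃ λ T → T ∈ˡ hyperEdges c ×
                     ∀ {c′} → c′ ∈ˡ T → val i c′ ≡ true × level i c′ < level i c)
                ⊎ (∃ λ c′ → c′ ∈ˡ negEdges c × ∀ {j} → i ≡ suc j → val j c′ ≡ false)

    field
      hyper-InLayer : ∀ {i c T c′} → InLayer i c → T ∈ˡ hyperEdges c → c′ ∈ˡ T → InLayer i c′
      neg-InLayer   : ∀ {i c c′} → InLayer i c → c′ ∈ˡ negEdges c →
                      ∃ λ j → i ≡ suc j × InLayer j c′
      val-hyper     : ∀ {i c T} → InLayer i c → T ∈ˡ hyperEdges c →
                      (∀ {c′} → c′ ∈ˡ T → val i c′ ≡ true) → val i c ≡ true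
      val-neg       : ∀ {j c c′} → InLayer (suc j) c → c′ ∈ˡ negEdges c → val j c′ ≡ false →
                      val (suc j) c ≡ true
      val-founded   : ∀ {i c} → InLayer i c → val i c ≡ true → Founded i c

-- Correctness by induction on the formula.

module Correctness {S : CGS} (valuation : Valuation S) where
  open CGS S
  open Semantics S
  open Encoding S
  open Plays S
  open Valuation valuation

  Correct : Formula k nΠ → Set
  Correct φ = ∀ i q → InLayer i ⟨ q ⨟ φ ⟩ → val i ⟨ q ⨟ φ ⟩ ≡ true ⇔ q ⊨ φ

  Obeys⇒out : ∀ {A q} l (Z : Strategies A) → l ⟨ 0 ⟩ ≡ q → Obeys Z l → l ∈out⟨ q , Z ⟩
  Obeys⇒out l Z e o = e , λ i → let v , f , e′ = o i in v , agrees f , e′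

  out⇒Obeys : ∀ {A q} l (Z : Strategies A) → l ∈out⟨ q , Z ⟩ → Obeys Z l
  out⇒Obeys l Z (_ , o) i = let v , f , e = o i in v , follows f , e

  module _ {A : Subset k} {φ : Formula k nΠ} (ih : Correct φ)
           {i q} (il : InLayer i ⟨ q ⨟ ⟪ A ⟫○ φ ⟩) where

    next-sound : val i ⟨ q ⨟ ⟪ A ⟫○ φ ⟩ ≡ true → q ⊨ ⟪ A ⟫○ φ
    next-sound e with val-founded il e
    ... | inj₂ (_ , () , _)
    ... | inj₁ (T , T∈ , h) with V , V∈ , refl ← ∈-map⁻ _ T∈
      with j , rep ← choice (d q) A V∈ = Z , wins
      where
      Z : Strategies A
      Z = override q j
      wins : ∀ l → l ∈out⟨ q , Z ⟩ → l ⟨ 1 ⟩ ⊨ φ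
      wins l (refl , o) with v , f , e ← o 0 = subst (_⊨ φ) e
        (to (ih i _ (hyper-InLayer il T∈ c∈)) (proj₁ (h c∈)))
        where
        c∈ : ⟨ δ q v ⨟ φ ⟩ ∈ˡ map ⟨_⨟ φ ⟩ (Δ q V)
        c∈ = ∈-map⁺ ⟨_⨟ φ ⟩ (∈-map⁺ (δ q) (follows⇒member rep
          (follows λ a a∈A → trans (f a a∈A) (override-at q j a a∈A))))

    -- Each target of the hyper-edge given by `Z` is the second state of some play in the outcome of
    -- `Z`: first the move vector that produces it, then arbitrary moves following `Z`.
    next-complete : q ⊨ ⟪ A ⟫○ φ → val i ⟨ q ⨟ ⟪ A ⟫○ φ ⟩ ≡ true
    next-complete (Z , h) with V , V∈ , rep ← partialMove (d q) A (at Z q) =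
      val-hyper il T∈ holds
      where
      T∈ : map ⟨_⨟ φ ⟩ (Δ q V) ∈ˡ hyperEdges ⟨ q ⨟ ⟪ A ⟫○ φ ⟩
      T∈ = ∈-map⁺ _ V∈
      holds : ∀ {c} → c ∈ˡ map ⟨_⨟ φ ⟩ (Δ q V) → val i c ≡ true
      holds c∈ with _ , s∈ , refl ← ∈-map⁻ _ c∈ with v , v∈ , refl ← ∈-map⁻ _ s∈ =
        from (ih i _ (hyper-InLayer il T∈ c∈)) (h l′ (Obeys⇒out l′ Z refl
          (cons-Obeys q v l refl Z (member⇒follows rep v∈) (run-Obeys Z (arbitraryMove Z) (δ q v)))))
        where
        l = run Z (arbitraryMove Z) (δ q v)
        l′ = cons q v l refl

  -- Until enforced by a coalition.

  module ExistsUntil {A : Subset k} {φ₁ φ₂ : Formula k nΠ}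
                     (ih₁ : Correct φ₁) (ih₂ : Correct φ₂) (i : ℕ) where

    ψ : Formula k nΠ
    ψ = ⟪ A ⟫ φ₁ U φ₂

    now : ∀ {q} → InLayer i ⟨ q ⨟ ψ ⟩ → InLayer i ⟨ q ⨟ φ₂ ⟩
    now il = hyper-InLayer il (here refl) (here refl)

    edge : ∀ {q V} → V ∈ˡ pmoves q A →
           ⟨ q ⨟ φ₁ ⟩ ∷ map ⟨_⨟ ψ ⟩ (Δ q V) ∈ˡ hyperEdges ⟨ q ⨟ ψ ⟩
    edge V∈ = there (∈-map⁺ _ V∈)

    Progress : State → State → Set
    Progress q s = val i ⟨ s ⨟ ψ ⟩ ≡ true × level i ⟨ s ⨟ ψ ⟩ < level i ⟨ q ⨟ ψ ⟩

    progress? : ∀ q (V : PartialMove (d q)) → Dec (ListAll.All (Progress q) (Δ q V))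
    progress? q V = ListAll.all?
      (λ s → (val i ⟨ s ⨟ ψ ⟩ Boolₚ.≟ true) ×-dec (level i ⟨ s ⨟ ψ ⟩ ℕ.<? level i ⟨ q ⨟ ψ ⟩)) (Δ q V)

    -- At each state a partial move is played all of whose results are true and of smaller level, if
    -- one exists.
    strategy : Strategies A
    strategy a a∈A q = proj₁ (select q A (progress? q)) a a∈A

    advance : ∀ {q} → InLayer i ⟨ q ⨟ ψ ⟩ → val i ⟨ q ⨟ ψ ⟩ ≡ true →
              q ⊨ φ₂ ⊎ (q ⊨ φ₁ × (∀ {v} → v Follows at strategy q →
                                  InLayer i ⟨ δ q v ⨟ ψ ⟩ × Progress q (δ q v)))
    advance {q} il e with val-founded il e
    ... | inj₂ (_ , () , _)
    ... | inj₁ (_ , here refl , h) = inj₁ (to (ih₂ i q (now il)) (proj₁ (h (here refl))))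
    ... | inj₁ (_ , there T∈ , h) with V , V∈ , refl ← ∈-map⁻ _ T∈
      -- The edge that justifies truth shows only that some partial move makes progress. The
      -- strategy may play another one, `W`, which makes progress as well.
      with W , W∈ , progress , rep ← proj₂ (select q A (progress? q)) V∈
             (ListAll.tabulate λ s∈ → h (there (∈-map⁺ ⟨_⨟ ψ ⟩ s∈))) =
      inj₂ (to (ih₁ i q (hyper-InLayer il (edge V∈) (here refl))) (proj₁ (h (here refl))) ,
            λ f → let s∈ = ∈-map⁺ (δ q) (follows⇒member rep f) in
              hyper-InLayer il (edge W∈) (there (∈-map⁺ ⟨_⨟ ψ ⟩ s∈)) , ListAll.lookup progress s∈)

    -- Recursion on a bound for the level: it drops with every move, so `φ₂` must hold before it is
    -- used up.
    wins : ∀ n l → Obeys strategy l → InLayer i ⟨ l ⟨ 0 ⟩ ⨟ ψ ⟩ → val i ⟨ l ⟨ 0 ⟩ ⨟ ψ ⟩ ≡ true →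
           level i ⟨ l ⟨ 0 ⟩ ⨟ ψ ⟩ < n → Until φ₁ φ₂ l
    wins (suc n) l o il e (s≤s lt) with advance il e
    ... | inj₁ h₂ = until-now {φ₁} l h₂
    ... | inj₂ (h₁ , f) with v , fol , eq ← o 0
      with il′ , e′ , lt′ ← subst (λ s → InLayer i ⟨ s ⨟ ψ ⟩ × Progress (l ⟨ 0 ⟩) s) eq (f fol) =
      until-later {φ₁} l h₁ (wins n (tail l) (o ∘ suc) il′ e′ (ℕ.<-≤-trans lt′ lt))

    sound : ∀ {q} → InLayer i ⟨ q ⨟ ψ ⟩ → val i ⟨ q ⨟ ψ ⟩ ≡ true → q ⊨ ψ
    sound il e = strategy , λ { l o@(refl , _) → wins _ l (out⇒Obeys l strategy o) il e ℕ.≤-refl }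

    module _ (Z : Strategies A) where

      -- A worst reply to `Z`: a false result is chosen whenever there is one, so a true result
      -- means that all results are true.
      adversary : ∀ q → ∃ λ (v : D q) → v Follows at Z q ×
                  (val i ⟨ δ q v ⨟ ψ ⟩ ≡ true → ∀ {w} → w Follows at Z q → val i ⟨ δ q w ⨟ ψ ⟩ ≡ true)
      adversary q with V , _ , rep ← partialMove (d q) A (at Z q)
        with Any.any? (λ v → val i ⟨ δ q v ⨟ ψ ⟩ Boolₚ.≟ false) (members V)
      ... | yes some = let v , v∈ , ¬e = find some in
        v , member⇒follows rep v∈ , λ e → contradiction (trans (sym e) ¬e) λ ()
      ... | no  none = let v , f = arbitraryMove Z q in
        v , f , λ _ f′ → ¬-not λ ¬e → none (lose (follows⇒member rep f′) ¬e)

      next : ∀ q → ∃ λ (v : D q) → v Follows at Z q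
      next q = let v , f , _ = adversary q in v , f

    complete : ∀ {q} → InLayer i ⟨ q ⨟ ψ ⟩ → q ⊨ ψ → val i ⟨ q ⨟ ψ ⟩ ≡ true
    complete {q} il (Z , h) =
      -- The predicate is an implication because membership in the component travels forwards along
      -- the play, truth backwards.
      until-backward {φ₁} {φ₂} (λ s → InLayer i ⟨ s ⨟ ψ ⟩ → val i ⟨ s ⨟ ψ ⟩ ≡ true) l
        (λ _ → base) (λ j → let _ , f , worst = adversary Z (l ⟨ j ⟩) in step f worst)
        (h l (Obeys⇒out l Z refl (run-Obeys Z (next Z) q))) il
      where
      l = run Z (next Z) q
      base : ∀ {s} → s ⊨ φ₂ → InLayer i ⟨ s ⨟ ψ ⟩ → val i ⟨ s ⨟ ψ ⟩ ≡ true
      base h₂ il = val-hyper il (here refl) λ { (here refl) → from (ih₂ i _ (now il)) h₂ }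
      step : ∀ {s v} → v Follows at Z s →
             (val i ⟨ δ s v ⨟ ψ ⟩ ≡ true → ∀ {w} → w Follows at Z s → val i ⟨ δ s w ⨟ ψ ⟩ ≡ true) →
             s ⊨ φ₁ → (InLayer i ⟨ δ s v ⨟ ψ ⟩ → val i ⟨ δ s v ⨟ ψ ⟩ ≡ true) →
             InLayer i ⟨ s ⨟ ψ ⟩ → val i ⟨ s ⨟ ψ ⟩ ≡ true
      step {s} {v} f worst h₁ later il with V , V∈ , rep ← partialMove (d s) A (at Z s) =
        val-hyper il (edge V∈) holds
        where
        later′ : val i ⟨ δ s v ⨟ ψ ⟩ ≡ true
        later′ = later (hyper-InLayer il (edge V∈)
          (there (∈-map⁺ ⟨_⨟ ψ ⟩ (∈-map⁺ (δ s) (follows⇒member rep f)))))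
        holds : ∀ {c} → c ∈ˡ ⟨ s ⨟ φ₁ ⟩ ∷ map ⟨_⨟ ψ ⟩ (Δ s V) → val i c ≡ true
        holds (here refl) = from (ih₁ i s (hyper-InLayer il (edge V∈) (here refl))) h₁
        holds (there c∈) with _ , s∈ , refl ← ∈-map⁻ _ c∈ with w , w∈ , refl ← ∈-map⁻ _ s∈ =
          worst later′ (member⇒follows rep w∈)

  -- Until that a coalition cannot avoid.

  module ForallUntil {A : Subset k} {φ₁ φ₂ : Formula k nΠ}
                     (ih₁ : Correct φ₁) (ih₂ : Correct φ₂) (i : ℕ) where

    ψ : Formula k nΠ
    ψ = ⟦ A ⟧ φ₁ U φ₂

    now : ∀ {q} → InLayer i ⟨ q ⨟ ψ ⟩ → InLayer i ⟨ q ⨟ φ₂ ⟩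
    now il = hyper-InLayer il (here refl) (here refl)

    hold : ∀ {q} → InLayer i ⟨ q ⨟ ψ ⟩ → InLayer i ⟨ q ⨟ φ₁ ⟩
    hold il = hyper-InLayer il (there (here refl)) (here refl)

    respond : ∀ {q V} → V ∈ˡ pmoves q A → InLayer i ⟨ q ⨟ ψ ⟩ → InLayer i ⟨ q ⨟ V ⨟ ψ ⟩
    respond V∈ il = hyper-InLayer il (there (here refl)) (there (∈-map⁺ ⟨ _ ⨟_⨟ ψ ⟩ V∈))

    edge : ∀ {q v} (V : PartialMove (d q)) → v ∈ˡ members V →
           (⟨ δ q v ⨟ ψ ⟩ ∷ []) ∈ˡ hyperEdges ⟨ q ⨟ V ⨟ ψ ⟩
    edge {q} _ v∈ = ∈-map⁺ (λ v → ⟨ δ q v ⨟ ψ ⟩ ∷ []) v∈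

    module _ (Z : Strategies A) where

      -- One round of the play crosses two edges: the hyper-edge to the triples offers the one for
      -- the partial move of `Z`, and the edge justifying that triple supplies the opponents' reply
      -- `v`. The level drops along both, and `n` bounds it.
      reaches : ∀ n q → InLayer i ⟨ q ⨟ ψ ⟩ → val i ⟨ q ⨟ ψ ⟩ ≡ true → level i ⟨ q ⨟ ψ ⟩ < n →
                ∃ λ l → l ⟨ 0 ⟩ ≡ q × Obeys Z l × Until φ₁ φ₂ l
      reaches (suc n) q il e (s≤s lt) with val-founded il e
      ... | inj₂ (_ , () , _)
      ... | inj₁ (_ , here refl , h) =
        l , refl , run-Obeys Z (arbitraryMove Z) q ,
        until-now {φ₁} l (to (ih₂ i q (now il)) (proj₁ (h (here refl))))
        where l = run Z (arbitraryMove Z) q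
      ... | inj₁ (_ , there (here refl) , h)
        with V , V∈ , rep ← partialMove (d q) A (at Z q)
        with e′ , lt′ ← h (there (∈-map⁺ ⟨ q ⨟_⨟ ψ ⟩ V∈))
        with val-founded (respond V∈ il) e′
      ...   | inj₂ (_ , () , _)
      ...   | inj₁ (_ , T∈ , h′)
        with v , v∈ , refl ← ∈-map⁻ _ T∈
        with e″ , lt″ ← h′ (here refl)
        with l , l₀≡ , o , u ← reaches n (δ q v)
               (hyper-InLayer (respond V∈ il) (edge V v∈) (here refl)) e″
               (ℕ.<-≤-trans lt″ (ℕ.≤-trans (ℕ.<⇒≤ lt′) lt)) =
        cons q v l l₀≡ , refl , cons-Obeys q v l l₀≡ Z (member⇒follows rep v∈) o ,
        until-later {φ₁} (cons q v l l₀≡) (to (ih₁ i q (hold il)) (proj₁ (h (here refl)))) u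

    sound : ∀ {q} → InLayer i ⟨ q ⨟ ψ ⟩ → val i ⟨ q ⨟ ψ ⟩ ≡ true → q ⊨ ψ
    sound {q} il e Z with l , l₀≡ , o , u ← reaches Z _ q il e ℕ.≤-refl = l , Obeys⇒out l Z l₀≡ o , u

    refuted? : ∀ q (V : PartialMove (d q)) → Dec (val i ⟨ q ⨟ V ⨟ ψ ⟩ ≡ false)
    refuted? q V = val i ⟨ q ⨟ V ⨟ ψ ⟩ Boolₚ.≟ false

    -- At each state the coalition plays a partial move whose triple is false, if one exists.
    refutation : Strategies A
    refutation a a∈A q = proj₁ (select q A (refuted? q)) a a∈A

    complete : ∀ {q} → InLayer i ⟨ q ⨟ ψ ⟩ → q ⊨ ψ → val i ⟨ q ⨟ ψ ⟩ ≡ true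
    complete {q} il h with l , out@(refl , _) , u ← h refutation =
      until-backward {φ₁} {φ₂} (λ s → InLayer i ⟨ s ⨟ ψ ⟩ → val i ⟨ s ⨟ ψ ⟩ ≡ true) l
        (λ _ → base) (λ j → step (out⇒Obeys l refutation out j)) u il
      where
      base : ∀ {s} → s ⊨ φ₂ → InLayer i ⟨ s ⨟ ψ ⟩ → val i ⟨ s ⨟ ψ ⟩ ≡ true
      base h₂ il = val-hyper il (here refl) λ { (here refl) → from (ih₂ i _ (now il)) h₂ }
      step : ∀ {s s′} → (∃ λ (v : D s) → v Follows at refutation s × δ s v ≡ s′) → s ⊨ φ₁ →
             (InLayer i ⟨ s′ ⨟ ψ ⟩ → val i ⟨ s′ ⨟ ψ ⟩ ≡ true) →
             InLayer i ⟨ s ⨟ ψ ⟩ → val i ⟨ s ⨟ ψ ⟩ ≡ true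
      step {s} (v , f , refl) h₁ later il = val-hyper il (there (here refl)) holds
        where
        -- If some triple at `s` were false, the refutation would play such a `W`. The move `v` of
        -- the play then belongs to `W`, and the truth of its result makes the triple for `W` true.
        unrefuted : ∀ {V} → V ∈ˡ pmoves s A → ¬ (val i ⟨ s ⨟ V ⨟ ψ ⟩ ≡ false)
        unrefuted V∈ ¬e with W , W∈ , ¬e′ , rep ← proj₂ (select s A (refuted? s)) V∈ ¬e =
          contradiction (trans (sym (val-hyper (respond W∈ il) (edge W v∈) λ { (here refl) →
            later (hyper-InLayer (respond W∈ il) (edge W v∈) (here refl)) })) ¬e′) λ ()
          where
          v∈ : v ∈ˡ members W
          v∈ = follows⇒member rep f
        holds : ∀ {c} → c ∈ˡ ⟨ s ⨟ φ₁ ⟩ ∷ map ⟨ s ⨟_⨟ ψ ⟩ (pmoves s A) → val i c ≡ true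
        holds (here refl) = from (ih₁ i s (hold il)) h₁
        holds (there c∈) with V , V∈ , refl ← ∈-map⁻ _ c∈ = ¬-not (unrefuted V∈)

  -- Propositions and the structural induction.

  atom-hyper⁺ : ∀ {q x} → x ∈ π q → [] ∈ˡ hyperEdges ⟨ q ⨟ atom x ⟩
  atom-hyper⁺ {q} {x} x∈ with x ∈? π q
  ... | yes _  = here refl
  ... | no x∉ = contradiction x∈ x∉

  atom-hyper⁻ : ∀ {q x T} → T ∈ˡ hyperEdges ⟨ q ⨟ atom x ⟩ → x ∈ π q
  atom-hyper⁻ {q} {x} T∈ with x ∈? π q
  ... | yes x∈ = x∈
  atom-hyper⁻ () | no _

  correct : ∀ φ → Correct φ
  correct verum i q il = mk⇔ _ λ _ → val-hyper il (here refl) λ ()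
  correct (atom x) i q il = mk⇔ sound λ x∈ → val-hyper il (atom-hyper⁺ x∈) λ ()
    where
    sound : val i ⟨ q ⨟ atom x ⟩ ≡ true → x ∈ π q
    sound e with val-founded il e
    ... | inj₁ (_ , T∈ , _) = atom-hyper⁻ {q} T∈
    ... | inj₂ (_ , () , _)
  -- The source of a negation edge lies in a component of positive index `suc j`; the hypothesis for
  -- `φ` is used at `j`, and each direction uses the opposite one.
  correct (∼ φ) i q il with j , refl , il′ ← neg-InLayer il (here refl) = mk⇔ sound complete
    where
    sound : val (suc j) ⟨ q ⨟ ∼ φ ⟩ ≡ true → ¬ (q ⊨ φ)
    sound e h with val-founded il e
    ... | inj₁ (_ , () , _)
    ... | inj₂ (_ , here refl , ¬e) =
      contradiction (trans (sym (from (correct φ j q il′) h)) (¬e refl)) λ ()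
    complete : ¬ (q ⊨ φ) → val (suc j) ⟨ q ⨟ ∼ φ ⟩ ≡ true
    complete ¬h = val-neg il (here refl) (¬-not λ e → ¬h (to (correct φ j q il′) e))
  correct (φ₁ ∨̇ φ₂) i q il = mk⇔ sound complete
    where
    il₁ = hyper-InLayer il (here refl) (here refl)
    il₂ = hyper-InLayer il (there (here refl)) (here refl)
    sound : val i ⟨ q ⨟ φ₁ ∨̇ φ₂ ⟩ ≡ true → q ⊨ φ₁ ⊎ q ⊨ φ₂
    sound e with val-founded il e
    ... | inj₁ (_ , here refl , h)         = inj₁ (to (correct φ₁ i q il₁) (proj₁ (h (here refl))))
    ... | inj₁ (_ , there (here refl) , h) = inj₂ (to (correct φ₂ i q il₂) (proj₁ (h (here refl))))
    ... | inj₂ (_ , () , _)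
    complete : q ⊨ φ₁ ⊎ q ⊨ φ₂ → val i ⟨ q ⨟ φ₁ ∨̇ φ₂ ⟩ ≡ true
    complete (inj₁ h) =
      val-hyper il (here refl) λ { (here refl) → from (correct φ₁ i q il₁) h }
    complete (inj₂ h) =
      val-hyper il (there (here refl)) λ { (here refl) → from (correct φ₂ i q il₂) h }
  correct (⟪ A ⟫○ φ) i q il = mk⇔ (next-sound (correct φ) il) (next-complete (correct φ) il)
  correct (⟪ A ⟫ φ₁ U φ₂) i q il = mk⇔ (sound il) (complete il)
    where open ExistsUntil {A} {φ₁} {φ₂} (correct φ₁) (correct φ₂) i
  correct (⟦ A ⟧ φ₁ U φ₂) i q il = mk⇔ (sound il) (complete il)
    where open ForallUntil {A} {φ₁} {φ₂} (correct φ₁) (correct φ₂) i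

-- From a graph that follows the encoding rules to a valuation of configurations.

module _ {S : CGS} where
  open Encoding S

  Enumerates : (Fin n → Config) → Subset n → List Config → Set
  Enumerates label V T = (∀ {x} → x ∈ V → label x ∈ˡ T)
                       × (∀ {c} → c ∈ˡ T → ∃ λ x → label x ≡ c × x ∈ V)

  record Encodes (G : EDG) (label : EDG.C G → Config) : Set where
    open EDG G
    field
      injective : ∀ x y → label x ≡ label y → x ≡ y
      hyper⁺    : ∀ {x T} → T ∈ˡ hyperEdges (label x) → ∃ λ V → (x , V) ∈ˡ E × Enumerates label V T
      hyper⁻    : ∀ {x V} → (x , V) ∈ˡ E → ∃ λ T → T ∈ˡ hyperEdges (label x) × Enumerates label V T
      neg⁺      : ∀ {x c} → c ∈ˡ negEdges (label x) → ∃ λ y → label y ≡ c × x ⇢ y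
      neg⁻      : ∀ {x y} → x ⇢ y → label y ∈ˡ negEdges (label x)

module EncodedGraph {S : CGS} {G : EDG} (safe : EDG.NegationSafe G)
                    {label : EDG.C G → Encoding.Config S} (encodes : Encodes G label) where
  open CGS S
  open Semantics S
  open Encoding S
  open EDG G
  open MinimumAssignment G safe using (dist; αminₖ; αmin; distG)
  open Layers G safe
  open Encodes encodes

  -- The default `b` is harmless: the laws of a `Valuation` concern configurations in a component,
  -- and these are all labels.
  extend : {B : Set} → B → (C → B) → Config → B
  extend b f c with any? (λ x → label x ≟ᶜ c)
  ... | yes (x , _) = f x
  ... | no  _       = b

  extend-label : {B : Set} (b : B) (f : C → B) (x : C) → extend b f (label x) ≡ f x
  extend-label b f x with any? (λ y → label y ≟ᶜ label x)
  ... | yes (y , e) = cong f (injective y x e)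
  ... | no  none    = contradiction (x , refl) none

  val : ℕ → Config → Bool
  val i = extend false (αminₖ i)

  level : ℕ → Config → ℕ
  level i = extend 0 (proj₁ (ranking i))

  val-label : ∀ i x → val i (label x) ≡ αminₖ i x
  val-label i = extend-label false (αminₖ i)

  InLayer : ℕ → Config → Set
  InLayer i c = ∃ λ x → label x ≡ c × dist x ≤ i

  hyper-InLayer : ∀ {i c T c′} → InLayer i c → T ∈ˡ hyperEdges c → c′ ∈ˡ T → InLayer i c′
  hyper-InLayer (x , refl , d≤i) T∈ c′∈ with V , e , _ , targets ← hyper⁺ T∈
    with y , l , y∈ ← targets c′∈ = y , l , ℕ.≤-trans (⟶⇒dist≤ (V , e , y∈)) d≤i

  predecessor : ∀ {m i} → m < i → ∃ λ j → i ≡ suc j × m ≤ j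
  predecessor (s≤s m≤j) = _ , refl , m≤j

  neg-InLayer : ∀ {i c c′} → InLayer i c → c′ ∈ˡ negEdges c → ∃ λ j → i ≡ suc j × InLayer j c′
  neg-InLayer (x , refl , d≤i) c′∈ with y , e , x⇢y ← neg⁺ c′∈
    -- The distance of `y` is strictly below that of `x`, which leaves room for a predecessor of
    -- `i`.
    with j , refl , d≤j ← predecessor (ℕ.≤-trans (⇢⇒dist< ε x⇢y) d≤i) = j , refl , y , e , d≤j

  val-hyper : ∀ {i c T} → InLayer i c → T ∈ˡ hyperEdges c →
              (∀ {c′} → c′ ∈ˡ T → val i c′ ≡ true) → val i c ≡ true
  val-hyper {i} (x , refl , d≤i) T∈ h with V , e , labels , _ ← hyper⁺ T∈ =
    trans (val-label i x) (αminₖ-closed i d≤i (inj₁ (V , e ,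
      λ {y} y∈ → trans (sym (val-label i y)) (h (labels y∈)))))

  val-neg : ∀ {j c c′} → InLayer (suc j) c → c′ ∈ˡ negEdges c → val j c′ ≡ false →
            val (suc j) c ≡ true
  val-neg {j} (x , refl , d≤i) c′∈ h with y , refl , x⇢y ← neg⁺ c′∈ =
    trans (val-label (suc j) x)
      (αminₖ-closed (suc j) d≤i (inj₂ (y , x⇢y , trans (sym (val-label j y)) h)))

  val-founded : ∀ {i c} → InLayer i c → val i c ≡ true →
                (∃ λ T → T ∈ˡ hyperEdges c ×
                   ∀ {c′} → c′ ∈ˡ T → val i c′ ≡ true × level i c′ < level i c)
              ⊎ (∃ λ c′ → c′ ∈ˡ negEdges c × ∀ {j} → i ≡ suc j → val j c′ ≡ false)
  val-founded {i} (x , refl , d≤i) e with proj₂ (ranking i) (trans (sym (val-label i x)) e)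
  -- Once `i` is known to be `suc j`, `previous i` is `αminₖ j`.
  ... | inj₂ (y , x⇢y , h) = inj₂ (label y , neg⁻ x⇢y , λ { {j} refl → trans (val-label j y) h })
  ... | inj₁ (_ , m , h) with T , T∈ , _ , targets ← hyper⁻ m = inj₁ (T , T∈ , below)
    where
    below : ∀ {c′} → c′ ∈ˡ T → val i c′ ≡ true × level i c′ < level i (label x)
    below c′∈ with y , refl , y∈ ← targets c′∈ =
      trans (val-label i y) (proj₁ (h y∈)) ,
      subst₂ _<_ (sym (extend-label 0 _ y)) (sym (extend-label 0 _ x)) (proj₂ (h y∈))

  valuation : Valuation S
  valuation = record
    { InLayer       = InLayer
    ; val           = val
    ; level         = level
    ; hyper-InLayer = hyper-InLayer
    ; neg-InLayer   = neg-InLayer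
    ; val-hyper     = val-hyper
    ; val-neg       = val-neg
    ; val-founded   = val-founded
    }

  αmin-correct : ∀ φ x q → label x ≡ ⟨ q ⨟ φ ⟩ → αmin x ≡ true ⇔ q ⊨ φ
  αmin-correct φ x q l = subst (λ b → b ≡ true ⇔ q ⊨ φ)
    (trans (cong (val distG) (sym l)) (val-label distG x))
    -- Every vertex lies in the last component, whose minimum assignment is `αmin`.
    (Correctness.correct valuation φ distG q (x , l , dist≤distG x))

-- The rooted graph follows the encoding rules.

module _ (S : CGS) (q₀ : CGS.State S) (φ₀ : Formula (CGS.k S) (CGS.nΠ S)) where
  open Encoding S
  open Rooted q₀ φ₀
  open EDG G

  private
    -- Vertices are reachable from the root, hence so are their successors, and every reachable
    -- configuration is a vertex.
    successor : ∀ x {c} → c ∈ˡ concat (hyperEdges (config x)) ++ negEdges (config x) →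
                ∃ λ y → config y ≡ c
    successor x m = let c∈ = configs-complete (configs-sound (∈-lookup x) ◅◅ (m ◅ ε)) in
      index c∈ , sym (lookup-index c∈)

    ⌞⌟⁺ : ∀ T {y c} → config y ≡ c → c ∈ˡ T → y ∈ ⌞ T ⌟
    ⌞⌟⁺ T {y} refl c∈ = lookup⇒[]= y ⌞ T ⌟
      (trans (lookup∘tabulate (λ i → does (config i ∈ᶜ? T)) y) (dec-true (config y ∈ᶜ? T) c∈))

  G-encodes : Encodes {S} G config
  G-encodes = record
    { injective = lookup-injective configs-unique
    ; hyper⁺    = hyper⁺
    ; hyper⁻    = hyper⁻
    ; neg⁺      = neg⁺
    ; neg⁻      = ⇢⁻
    }
    where
    edges : C → List (Subset size)
    edges i = map ⌞_⌟ (hyperEdges (config i))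
    negs : C → List C
    negs i = filter (λ j → config j ∈ᶜ? negEdges (config i)) (allFin _)
    enumerates : ∀ x {T} → T ∈ˡ hyperEdges (config x) → Enumerates config ⌞ T ⌟ T
    enumerates x {T} T∈ = ⌞⌟⁻ T , λ c∈ →
      let y , e = successor x (∈-++⁺ˡ (∈-concat⁺′ c∈ T∈)) in y , e , ⌞⌟⁺ T e c∈
    hyper⁺ : ∀ {x T} → T ∈ˡ hyperEdges (config x) → ∃ λ V → (x , V) ∈ˡ E × Enumerates config V T
    hyper⁺ {x} {T} T∈ = ⌞ T ⌟ , ∈-edgesOf⁺ edges (∈-map⁺ ⌞_⌟ T∈) , enumerates x T∈
    hyper⁻ : ∀ {x V} → (x , V) ∈ˡ E → ∃ λ T → T ∈ˡ hyperEdges (config x) × Enumerates config V T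
    hyper⁻ {x} e = image (∈-map⁻ ⌞_⌟ (∈-edgesOf⁻ edges e))
      where
      image : ∀ {V} → (∃ λ T → T ∈ˡ hyperEdges (config x) × V ≡ ⌞ T ⌟) →
              ∃ λ T → T ∈ˡ hyperEdges (config x) × Enumerates config V T
      image (T , T∈ , refl) = T , T∈ , enumerates x T∈
    neg⁺ : ∀ {x c} → c ∈ˡ negEdges (config x) → ∃ λ y → config y ≡ c × x ⇢ y
    neg⁺ {x} c∈ = image (successor x (∈-++⁺ʳ (concat (hyperEdges (config x))) c∈)) c∈
      where
      image : ∀ {c} → (∃ λ y → config y ≡ c) → c ∈ˡ negEdges (config x) →
              ∃ λ y → config y ≡ c × x ⇢ y
      image (y , refl) c∈ = y , refl , ∈-edgesOf⁺ negs
        (∈-filter⁺ (λ j → config j ∈ᶜ? negEdges (config x)) (∈-allFin y) c∈)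

theorem3p1 : (S : CGS) (q : CGS.State S) (φ : Formula (CGS.k S) (CGS.nΠ S)) →
    let open Semantics S
        open Encoding S
        open Rooted q φ
    in (αmin rootIndex ≡ true) ⇔ (q ⊨ φ)
theorem3p1 S q φ =
  EncodedGraph.αmin-correct G-negationSafe (G-encodes S q φ) φ rootIndex q config-rootIndex
  where
  open Encoding S
  open Rooted q φ
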